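{- Let $n$ be a positive integer. Then $$t(1,1,8;n)-\frac 12N(1,1,8;8n+10)=t(1,1,8;n)-\frac 13r_3(4n+5)=\begin{cases}2(-1)^{\frac{m+1}2}m&\text{if }4n+5=m^2\text{ for some positive integer }m,\\0&\text{otherwise.}\end{cases}$$
   Context: For positive integers $a_1,\dots,a_k$ and a nonnegative integer $n$, $N(a_1,\dots,a_k;n)$ is the number of $(x_1,\dots,x_k)\in\mathbb Z^k$ with $n=a_1x_1^2+\cdots+a_kx_k^2$, and $t(a_1,\dots,a_k;n)$ is the number of $(x_1,\dots,x_k)\in\mathbb Z^k$ with $n=a_1\frac{x_1(x_1-1)}2+\cdots+a_k\frac{x_k(x_k-1)}2$. Also $r_3(n)=N(1,1,1;n)$. -}

module Defs where

open import Data.Nat as ℕ using (ℕ; zero; suc)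
open import Data.Integer as ℤ using (ℤ; +_; -[1+_]; _-_; _*_; _/ℕ_)
open import Data.List using (List; []; _∷_; map; upTo)
open import Data.Nat.ListAction using (sum)
open import Relation.Nullary.Decidable using (⌊_⌋)
open import Data.Bool using (if_then_else_)

range : ℕ → List ℤ
range B = map (λ i → + i - + B) (upTo (suc (2 ℕ.* B)))

count : (ℤ → ℤ) → List ℕ → ℕ → ℤ → ℕ
count g [] B m = if ⌊ m ℤ.≟ + 0 ⌋ then 1 else 0
count g (a ∷ as) B m = sum (map (λ x → count g as B (m - + a * g x)) (range B))

sq : ℤ → ℤ
sq x = x * x

-- x(x-1)/2 (always an exact division, floor division by 2)
tri : ℤ → ℤ
tri x = (x * (x - + 1)) /ℕ 2

-- N(a₁,…,a_k; n) for positive a_i: every solution has |x_i| ≤ n+1,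
-- so enumerating [-(n+1), n+1]^k counts all integer solutions.
N : List ℕ → ℕ → ℕ
N as n = count sq as (suc n) (+ n)

-- t(a₁,…,a_k; n) for positive a_i: x(x-1)/2 ≤ n forces -n ≤ x ≤ n+1.
t : List ℕ → ℕ → ℕ
t as n = count tri as (suc n) (+ n)

r₃ : ℕ → ℕ
r₃ n = N (1 ∷ 1 ∷ 1 ∷ []) n

RHS : ℕ → ℤ → Set
RHS n v = (Σ ℕ λ m → (0 ℕ.< m) × (4 ℕ.* n ℕ.+ 5 ≡ m ℕ.* m)
                 × (v ≡ + 2 * (-[1+ 0 ] ℤ.^ (suc m ℕ./ 2)) * + m))
        ⊎ ((¬ Σ ℕ λ m → (0 ℕ.< m) × (4 ℕ.* n ℕ.+ 5 ≡ m ℕ.* m)) × (v ≡ + 0))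
  where
  open import Data.Product using (Σ; _×_)
  open import Data.Sum using (_⊎_)
  open import Relation.Nullary using (¬_)
  open import Relation.Binary.PropositionalEquality using (_≡_)

{-# OPTIONS --safe #-}
-- Write M = 4n + 5. The substitutions (x + y - 1, x - y, 4z - 2) and (a + b, a - b, z) express all three counts
-- through the solutions of a² + b² + c² = M, and t - N/2 = t - r₃/3 becomes minus the sum of (-1)^(c/2) over the
-- solutions with a odd and b, c even. Its generating function is the product θ₂θ₃θ₄, and the theorem is Jacobi's
-- derivative formula θ₁′ = θ₂θ₃θ₄. The latter is proved by comparing logarithmic derivatives in the nome: the required
-- relation says that m (m² - a² - b² - c²), suitably signed, sums to zero over the vectors of given norm in ℤ⁴ with
-- m, a odd and b, c even. Symmetrised under m ↔ c, a ↔ b, the sign is invariant under the reflection that takes m to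
-- (m + a + b + c) / 2; apply this to the polynomial m³ and average over the sign changes of a, b, c.
module Submission where

open import Defs
open import Data.Bool using (if_then_else_)
open import Data.Fin as Fin using (Fin; toℕ)
open import Data.Fin.Patterns using (0F; 1F; 2F; 3F)
import Data.Fin.Properties as FinP
open import Data.Integer as ℤ using (ℤ; +_; -[1+_]; -_; _+_; _-_; _*_; ∣_∣)
open import Data.Integer.DivMod using (_%ℕ_; _/ℕ_; n%ℕd<d; a≡a%ℕn+[a/ℕn]*n)
import Data.Integer.Properties as ℤP
open import Algebra.Properties.AbelianGroup ℤP.+-0-abelianGroup using (∙-cancelʳ)
open import Data.Integer.Tactic.RingSolver using (solve-∀)
open import Data.List using (List; []; _∷_; _++_; map; filter; concatMap; upTo)
open import Data.List.Membership.Propositional using (_∈_; find; lose)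
open import Data.List.Membership.Propositional.Properties using (∈-map⁺; ∈-map⁻; ∈-concatMap⁺; ∈-concatMap⁻; ∈-filter⁺; ∈-filter⁻; ∈-upTo⁺; ∈-upTo⁻)
open import Data.List.Membership.Propositional.Properties.WithK using (unique∧set⇒bag)
open import Data.List.Relation.Binary.BagAndSetEquality using (∼bag⇒↭)
open import Data.List.Relation.Binary.Permutation.Propositional as ↭ using (_↭_)
open import Data.List.Relation.Unary.All as All using ([]; _∷_)
open import Data.List.Relation.Unary.AllPairs using ([]; _∷_)
open import Data.List.Relation.Unary.Any using (here; there)
open import Data.List.Relation.Unary.Unique.Propositional using (Unique)
import Data.List.Relation.Unary.Unique.Propositional.Properties as Uniq
open import Data.Nat as ℕ using (ℕ; _<_)
import Data.Nat.DivMod as ℕD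
open import Data.Nat.Induction using (<-rec)
open import Data.Nat.ListAction using (sum)
import Data.Nat.Properties as ℕP
open import Data.Product using (_×_; _,_; ∃; proj₁; proj₂)
open import Data.Sum using (_⊎_; inj₁; inj₂)
open import Function using (_∘_; mk⇔)
open import Relation.Binary.PropositionalEquality using (_≡_; _≢_; refl; sym; trans; cong; cong₂; subst; module ≡-Reasoning)
open import Relation.Nullary using (¬_; yes; no; ¬?; contradiction)
open import Relation.Nullary.Decidable using (True; toWitness; _→-dec_; ⌊_⌋)
open import Relation.Unary using (Decidable)

-- Sums over enumerated sets

-- Let A, B, C be the sums of w m³, w m (a² + b² + c²) and w (m + a + b + c)³ over the vectors of
-- given norm, with w = `weight`. The relation wanted is A = B; its polynomial m³ - m (a² + b² + c²)
-- is a harmonic cubic. The average over signs leaves C = A + 3B, so the reflection has to supply 8A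
-- = 2C. The obstacle is that w is not invariant: the reflection sends (1, -1, 0, 0), where w = 1,
-- to (0, 0, 1, 1), where w = 0 but the swapped weight is 1. Symmetrising repairs this and also
-- yields the factor 2. The swapped weight is even in m, so it contributes nothing to the sum of m³,
-- whereas m + a + b + c is symmetric under the swap, so C occurs twice. All signs depend only on
-- residues modulo 4, so every invariance is a finite check.

private
  variable
    X Y : Set

∑ : List X → (X → ℤ) → ℤ
∑ []       F = + 0
∑ (x ∷ xs) F = F x + ∑ xs F

∑-cong : ∀ (xs : List X) {F G} → (∀ x → x ∈ xs → F x ≡ G x) → ∑ xs F ≡ ∑ xs G
∑-cong []       eq = refl
∑-cong (x ∷ xs) eq = cong₂ _+_ (eq x (here refl)) (∑-cong xs (λ y → eq y ∘ there))

∑-+ : ∀ (xs : List X) F G → ∑ xs (λ x → F x + G x) ≡ ∑ xs F + ∑ xs G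
∑-+ []       F G = refl
∑-+ (x ∷ xs) F G rewrite ∑-+ xs F G = interchange (F x) (G x) (∑ xs F) (∑ xs G)
  where
  interchange : ∀ p q r s → p + q + (r + s) ≡ p + r + (q + s)
  interchange = solve-∀

∑-*ˡ : ∀ (xs : List X) k F → ∑ xs (λ x → k * F x) ≡ k * ∑ xs F
∑-*ˡ []       k F = sym (ℤP.*-zeroʳ k)
∑-*ˡ (x ∷ xs) k F rewrite ∑-*ˡ xs k F = sym (ℤP.*-distribˡ-+ k (F x) (∑ xs F))

∑-++ : ∀ (xs ys : List X) F → ∑ (xs ++ ys) F ≡ ∑ xs F + ∑ ys F
∑-++ []       ys F = sym (ℤP.+-identityˡ _)
∑-++ (x ∷ xs) ys F rewrite ∑-++ xs ys F = sym (ℤP.+-assoc (F x) _ _)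

∑-map : ∀ (f : X → Y) xs F → ∑ (map f xs) F ≡ ∑ xs (F ∘ f)
∑-map f []       F = refl
∑-map f (x ∷ xs) F = cong (λ z → F (f x) + z) (∑-map f xs F)

∑-concatMap : ∀ (f : X → List Y) xs F → ∑ (concatMap f xs) F ≡ ∑ xs (λ x → ∑ (f x) F)
∑-concatMap f []       F = refl
∑-concatMap f (x ∷ xs) F =
  trans (∑-++ (f x) (concatMap f xs) F) (cong (λ z → ∑ (f x) F + z) (∑-concatMap f xs F))

∑-↭ : ∀ {xs ys : List X} F → xs ↭ ys → ∑ xs F ≡ ∑ ys F
∑-↭ F ↭.refl                = refl
∑-↭ F (↭.prep x p)            = cong (λ z → F x + z) (∑-↭ F p)
∑-↭ F (↭.swap {xs} {ys} x y p) rewrite ∑-↭ F p = exchange (F x) (F y) (∑ ys F)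
  where
  exchange : ∀ a b c → a + (b + c) ≡ b + (a + c)
  exchange = solve-∀
∑-↭ F (↭.trans p q)         = trans (∑-↭ F p) (∑-↭ F q)

∑-filter : ∀ {Q : X → Set} (Q? : Decidable Q) xs F → (∀ x → ¬ Q x → F x ≡ + 0) → ∑ (filter Q? xs) F ≡ ∑ xs F
∑-filter Q? []       F off = refl
∑-filter Q? (x ∷ xs) F off with Q? x
... | yes _ = cong (λ z → F x + z) (∑-filter Q? xs F off)
... | no ¬q = trans (∑-filter Q? xs F off)
                    (trans (sym (ℤP.+-identityˡ _)) (cong (_+ ∑ xs F) (sym (off x ¬q))))

-- Once the terms with value zero are filtered out, both lists have the same members without
-- repetition, so they are equal as bags and permutations of each other.
∑-⊆ : ∀ {xs ys : List X} F → Unique xs → Unique ys → (∀ {x} → x ∈ xs → x ∈ ys) →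
      (∀ {y} → y ∈ ys → y ∈ xs ⊎ F y ≡ + 0) → ∑ xs F ≡ ∑ ys F
∑-⊆ {xs = xs} {ys} F xs! ys! ⊆ys covered = begin
  ∑ xs F               ≡⟨ ∑-filter nz? xs F zero-off ⟨
  ∑ (filter nz? xs) F  ≡⟨ ∑-↭ F (∼bag⇒↭ (unique∧set⇒bag (Uniq.filter⁺ nz? xs!) (Uniq.filter⁺ nz? ys!) (mk⇔ to from))) ⟩
  ∑ (filter nz? ys) F  ≡⟨ ∑-filter nz? ys F zero-off ⟩
  ∑ ys F               ∎
  where
  open ≡-Reasoning
  nz? : Decidable (λ x → F x ≢ + 0)
  nz? x = ¬? (F x ℤ.≟ + 0)
  zero-off : ∀ x → ¬ (F x ≢ + 0) → F x ≡ + 0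
  zero-off x ¬nz with F x ℤ.≟ + 0
  ... | yes z = z
  ... | no nz = contradiction nz ¬nz
  to : ∀ {x} → x ∈ filter nz? xs → x ∈ filter nz? ys
  to x∈ with ∈-filter⁻ nz? {xs = xs} x∈
  ... | x∈xs , nz = ∈-filter⁺ nz? (⊆ys x∈xs) nz
  from : ∀ {x} → x ∈ filter nz? ys → x ∈ filter nz? xs
  from y∈ with ∈-filter⁻ nz? {xs = ys} y∈
  ... | y∈ys , nz with covered y∈ys
  ... | inj₁ y∈xs = ∈-filter⁺ nz? y∈xs nz
  ... | inj₂ z    = contradiction z nz

-- Injectivity is asked on the list only: forgetting `(i , j)` in `wronskian`, for instance, is
-- injective on the fibres but not on all tuples.
map-unique : ∀ (f : X → Y) {xs} → (∀ {x y} → x ∈ xs → y ∈ xs → f x ≡ f y → x ≡ y) →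
             Unique xs → Unique (map f xs)
map-unique f inj []           = []
map-unique f inj (x∉xs ∷ xs!) =
  All.tabulate (λ y∈ fx≡y → let z , z∈ , y≡fz = ∈-map⁻ f y∈ in
    All.lookup x∉xs z∈ (inj (here refl) (there z∈) (trans fx≡y y≡fz)))
  ∷ map-unique f (λ p q → inj (there p) (there q)) xs!

record Enumeration {X : Set} (P : X → Set) : Set where
  field
    elements : List X
    unique   : Unique elements
    sound    : ∀ {x} → x ∈ elements → P x
    complete : ∀ {x} → P x → x ∈ elements

open Enumeration

∑[_]_ : {P : X → Set} → Enumeration P → (X → ℤ) → ℤ
∑[ E ] F = ∑ (elements E) F

infix 9 ∑[_]_

∑[]-cong : ∀ {P : X → Set} (E : Enumeration P) {F G} → (∀ x → P x → F x ≡ G x) → ∑[ E ] F ≡ ∑[ E ] G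
∑[]-cong E eq = ∑-cong (elements E) (λ x → eq x ∘ sound E)

∑[]-zero : ∀ {P : X → Set} (E : Enumeration P) {F} → (∀ x → P x → F x ≡ + 0) → ∑[ E ] F ≡ + 0
∑[]-zero E {F} eq = trans (∑[]-cong E eq) (∑-*ˡ (elements E) (+ 0) F)

-- Points outside the image are allowed where `G` vanishes. A sum over a restricted set thus becomes
-- a sum over all solutions, with the restriction moved into a factor that depends on residues.
∑[]-reindex : ∀ {P : X → Set} {Q : Y → Set} (E : Enumeration P) (E′ : Enumeration Q) (f : X → Y) {F G} →
  (∀ x → P x → Q (f x)) →
  (∀ {x y} → P x → P y → f x ≡ f y → x ≡ y) →
  (∀ y → Q y → (∃ λ x → P x × y ≡ f x) ⊎ G y ≡ + 0) →
  (∀ x → P x → F x ≡ G (f x)) →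
  ∑[ E ] F ≡ ∑[ E′ ] G
∑[]-reindex E E′ f {F} {G} maps inj onto eq = begin
  ∑[ E ] F                  ≡⟨ ∑[]-cong E eq ⟩
  ∑[ E ] (G ∘ f)            ≡⟨ ∑-map f (elements E) G ⟨
  ∑ (map f (elements E)) G  ≡⟨ ∑-⊆ G (map-unique f (λ p q → inj (sound E p) (sound E q)) (unique E)) (unique E′) sub cov ⟩
  ∑[ E′ ] G                 ∎
  where
  open ≡-Reasoning
  sub : ∀ {y} → y ∈ map f (elements E) → y ∈ elements E′
  sub y∈ with ∈-map⁻ f y∈
  ... | x , x∈ , refl = complete E′ (maps x (sound E x∈))
  cov : ∀ {y} → y ∈ elements E′ → y ∈ map f (elements E) ⊎ G y ≡ + 0
  cov {y} y∈ with onto y (sound E′ y∈)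
  ... | inj₁ (x , p , refl) = inj₁ (∈-map⁺ f (complete E p))
  ... | inj₂ z              = inj₂ z

∑[]-involution : ∀ {P : X → Set} (E : Enumeration P) (σ : X → X) {F G} →
  (∀ x → σ (σ x) ≡ x) → (∀ x → P x → P (σ x)) → (∀ x → P x → F x ≡ G (σ x)) →
  ∑[ E ] F ≡ ∑[ E ] G
∑[]-involution E σ σσ maps =
  ∑[]-reindex E E σ maps
    (λ {x} {y} _ _ eq → trans (sym (σσ x)) (trans (cong σ eq) (σσ y)))
    (λ y q → inj₁ (σ y , maps y q , sym (σσ y)))

singleton : (x : X) → Enumeration (_≡ x)
singleton x = record
  { elements = x ∷ []
  ; unique   = [] ∷ []
  ; sound    = λ { (here eq) → eq }
  ; complete = here
  }

∑[]-single : ∀ {P : X → Set} (E : Enumeration P) x {F} → P x →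
  (∀ y → P y → y ≡ x ⊎ F y ≡ + 0) → ∑[ E ] F ≡ F x
∑[]-single E x {F} p off = trans (sym (∑[]-reindex (singleton x) E (λ y → y)
    (λ { y refl → p }) (λ _ _ eq → eq)
    onto (λ _ _ → refl)))
  (ℤP.+-identityʳ (F x))
  where
  onto : ∀ y → _ → (∃ λ z → z ≡ x × y ≡ z) ⊎ F y ≡ + 0
  onto y q with off y q
  ... | inj₁ y≡x = inj₁ (y , y≡x , refl)
  ... | inj₂ z   = inj₂ z

subset : {P Q : X → Set} → Decidable Q → (∀ x → Q x → P x) → Enumeration P → Enumeration Q
subset Q? Q⊆P E = record
  { elements = filter Q? (elements E)
  ; unique   = Uniq.filter⁺ Q? (unique E)
  ; sound    = λ x∈ → proj₂ (∈-filter⁻ Q? {xs = elements E} x∈)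
  ; complete = λ q → ∈-filter⁺ Q? (complete E (Q⊆P _ q)) q
  }

module _ {P : X → Set} {R : X → Y → Set} (E : Enumeration P) (E′ : ∀ x → Enumeration (R x)) where

  private
    fibre : X → List (X × Y)
    fibre x = map (x ,_) (elements (E′ x))

    fibres⁻ : ∀ {xs x y} → (x , y) ∈ concatMap fibre xs → x ∈ xs × R x y
    fibres⁻ z∈ with find (∈-concatMap⁻ fibre z∈)
    ... | x , x∈ , z∈′ with ∈-map⁻ (x ,_) z∈′
    ... | y , y∈ , refl = x∈ , sound (E′ x) y∈

    fibres! : ∀ {xs} → Unique xs → Unique (concatMap fibre xs)
    fibres! []                          = []
    fibres! {xs = x ∷ xs} xxs!@(_ ∷ xs!) =
      Uniq.++⁺ (Uniq.map⁺ (λ { refl → refl }) (unique (E′ x))) (fibres! xs!) disj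
      where
      disj : ∀ {z} → ¬ (z ∈ fibre x × z ∈ concatMap fibre xs)
      disj (z∈ , z∈′) with ∈-map⁻ (x ,_) z∈
      ... | y , _ , refl = Uniq.Unique[x∷xs]⇒x∉xs xxs! (proj₁ (fibres⁻ z∈′))

  dependentPairs : Enumeration (λ ((x , y) : X × Y) → P x × R x y)
  dependentPairs = record
    { elements = concatMap fibre (elements E)
    ; unique   = fibres! (unique E)
    ; sound    = λ z∈ → let x∈ , r = fibres⁻ {elements E} z∈ in sound E x∈ , r
    ; complete = λ { (p , r) → ∈-concatMap⁺ fibre (lose (complete E p) (∈-map⁺ (_ ,_) (complete (E′ _) r))) }
    }

  ∑[]-dependentPairs : ∀ F → ∑[ dependentPairs ] F ≡ ∑[ E ] (λ x → ∑[ E′ x ] (λ y → F (x , y)))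
  ∑[]-dependentPairs F = trans (∑-concatMap fibre (elements E) F)
    (∑-cong (elements E) (λ x _ → ∑-map (x ,_) (elements (E′ x)) F))

pairs : {P : X → Set} {Q : Y → Set} → Enumeration P → Enumeration Q → Enumeration (λ ((x , y) : X × Y) → P x × Q y)
pairs E E′ = dependentPairs E (λ _ → E′)

-- Residues modulo 4

ℤ₄ : Set
ℤ₄ = Fin 4

infixl 6 _⊕_
infixl 7 _⊗_

-- Tables rather than reductions of natural numbers modulo 4, so that sums of variables do not unfold.
succ₄ : ℤ₄ → ℤ₄
succ₄ 0F = 1F
succ₄ 1F = 2F
succ₄ 2F = 3F
succ₄ 3F = 0F

_⊕_ _⊗_ : ℤ₄ → ℤ₄ → ℤ₄
0F ⊕ s = s
1F ⊕ s = succ₄ s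
2F ⊕ s = succ₄ (succ₄ s)
3F ⊕ s = succ₄ (succ₄ (succ₄ s))
0F ⊗ s = 0F
1F ⊗ s = s
2F ⊗ s = s ⊕ s
3F ⊗ s = s ⊕ s ⊕ s

⊕-mod : ∀ r s → (toℕ r ℕ.+ toℕ s) ℕD.mod 4 ≡ r ⊕ s
⊕-mod = toWitness {a? = FinP.all? λ r → FinP.all? λ s → (toℕ r ℕ.+ toℕ s) ℕD.mod 4 Fin.≟ r ⊕ s} _

⊗-mod : ∀ r s → (toℕ r ℕ.* toℕ s) ℕD.mod 4 ≡ r ⊗ s
⊗-mod = toWitness {a? = FinP.all? λ r → FinP.all? λ s → (toℕ r ℕ.* toℕ s) ℕD.mod 4 Fin.≟ r ⊗ s} _

quot : ℤ → ℤ
quot x = x /ℕ 4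

opaque
  -- Opaque, so that residues of symbolic integers stay neutral and are rewritten only by the laws
  -- below. Apart from `cl-quot`, only the initial coefficients of the two series unfold it.
  cl : ℤ → ℤ₄
  cl x = Fin.fromℕ< (n%ℕd<d x 4)

  cl-quot : ∀ x → x ≡ + toℕ (cl x) + quot x * + 4
  cl-quot x = trans (a≡a%ℕn+[a/ℕn]*n x 4)
    (cong (λ r → + r + quot x * + 4) (sym (FinP.toℕ-fromℕ< (n%ℕd<d x 4))))

-- The difference of the remainders is a multiple of 4 of absolute value below 4, hence zero.
remainder-unique : ∀ (r s : ℤ₄) p q → + toℕ r + p * + 4 ≡ + toℕ s + q * + 4 → r ≡ s
remainder-unique r s p q eq = FinP.toℕ-injective (ℤP.+-injective (ℤP.i-j≡0⇒i≡j _ _ r-s≡0))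
  where
  rearrange : ∀ a b p q → a - b ≡ (q - p) * + 4 + ((a + p * + 4) - (b + q * + 4))
  rearrange = solve-∀
  r-s : + toℕ r - + toℕ s ≡ (q - p) * + 4
  r-s = trans (rearrange (+ toℕ r) (+ toℕ s) p q)
    (trans (cong (λ z → (q - p) * + 4 + z) (ℤP.i≡j⇒i-j≡0 eq)) (ℤP.+-identityʳ _))
  small : ∣ q - p ∣ ℕ.* 4 ℕ.< 1 ℕ.* 4
  small = begin-strict
    ∣ q - p ∣ ℕ.* 4            ≡⟨ ℤP.abs-* (q - p) (+ 4) ⟨
    ∣ (q - p) * + 4 ∣          ≡⟨ cong ∣_∣ r-s ⟨
    ∣ + toℕ r - + toℕ s ∣      ≡⟨ cong ∣_∣ (ℤP.m-n≡m⊖n (toℕ r) (toℕ s)) ⟩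
    ∣ toℕ r ℤ.⊖ toℕ s ∣        ≤⟨ ℤP.∣m⊝n∣≤m⊔n (toℕ r) (toℕ s) ⟩
    toℕ r ℕ.⊔ toℕ s            <⟨ ℕP.⊔-pres-<m (FinP.toℕ<n r) (FinP.toℕ<n s) ⟩
    4                          ∎
    where open ℕP.≤-Reasoning
  r-s≡0 : + toℕ r - + toℕ s ≡ + 0
  r-s≡0 = trans r-s (cong (_* + 4) {q - p} {+ 0}
    (ℤP.∣i∣≡0⇒i≡0 (ℕP.n<1⇒n≡0 (ℕP.*-cancelʳ-< 4 _ 1 small))))

-- `n` need not be a reduced remainder, so sums and products of remainders can be inserted directly.
cl-unique : ∀ {x} n q → x ≡ + n + q * + 4 → cl x ≡ n ℕD.mod 4
cl-unique {x} n q eq = remainder-unique _ _ (quot x) (+ (n ℕ./ 4) + q) (begin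
  + toℕ (cl x) + quot x * + 4                     ≡⟨ cl-quot x ⟨
  x                                               ≡⟨ eq ⟩
  + n + q * + 4                                   ≡⟨ cong (λ z → + z + q * + 4) (ℕD.m≡m%n+[m/n]*n n 4) ⟩
  + (n ℕ.% 4) + + (n ℕ./ 4 ℕ.* 4) + q * + 4       ≡⟨ cong (λ z → + (n ℕ.% 4) + z + q * + 4) (ℤP.pos-* (n ℕ./ 4) 4) ⟩
  + (n ℕ.% 4) + + (n ℕ./ 4) * + 4 + q * + 4       ≡⟨ collect (+ (n ℕ.% 4)) (+ (n ℕ./ 4)) q ⟩
  + (n ℕ.% 4) + (+ (n ℕ./ 4) + q) * + 4           ≡⟨ cong (λ z → + z + (+ (n ℕ./ 4) + q) * + 4) (sym (FinP.toℕ-fromℕ< (ℕD.m%n<n n 4))) ⟩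
  + toℕ (n ℕD.mod 4) + (+ (n ℕ./ 4) + q) * + 4    ∎)
  where
  open ≡-Reasoning
  collect : ∀ a b c → a + b * + 4 + c * + 4 ≡ a + (b + c) * + 4
  collect = solve-∀

cl-shift : ∀ x q → cl (x + q * + 4) ≡ cl x
cl-shift x q = trans (cl-unique (toℕ (cl x)) (quot x + q) (trans (cong (_+ q * + 4) (cl-quot x)) (collect (+ toℕ (cl x)) (quot x) q)))
  (sym (cl-unique (toℕ (cl x)) (quot x) (cl-quot x)))
  where
  collect : ∀ r p q → r + p * + 4 + q * + 4 ≡ r + (p + q) * + 4
  collect = solve-∀

cl-const : ∀ n → cl (+ n) ≡ n ℕD.mod 4
cl-const n = cl-unique n (+ 0) (sym (ℤP.+-identityʳ (+ n)))

cl-+ : ∀ x y → cl (x + y) ≡ cl x ⊕ cl y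
cl-+ x y = trans (cl-unique (toℕ (cl x) ℕ.+ toℕ (cl y)) (quot x + quot y)
  (trans (cong₂ _+_ (cl-quot x) (cl-quot y)) (expand (+ toℕ (cl x)) (+ toℕ (cl y)) (quot x) (quot y)))) (⊕-mod (cl x) (cl y))
  where
  expand : ∀ r s p q → (r + p * + 4) + (s + q * + 4) ≡ r + s + (p + q) * + 4
  expand = solve-∀

cl-* : ∀ x y → cl (x * y) ≡ cl x ⊗ cl y
cl-* x y = trans (cl-unique (r ℕ.* s) (+ r * q + p * + s + p * q * + 4)
  (trans (cong₂ _*_ (cl-quot x) (cl-quot y))
    (trans (expand (+ r) (+ s) p q) (cong (_+ (+ r * q + p * + s + p * q * + 4) * + 4) (sym (ℤP.pos-* r s)))))) (⊗-mod (cl x) (cl y))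
  where
  r = toℕ (cl x)
  s = toℕ (cl y)
  p = quot x
  q = quot y
  expand : ∀ r s p q → (r + p * + 4) * (s + q * + 4) ≡ r * s + (r * q + p * s + p * q * + 4) * + 4
  expand = solve-∀

cl-neg : ∀ x → cl (- x) ≡ 3F ⊗ cl x
cl-neg x = trans (cong cl (sym (ℤP.-1*i≡-i x)))
  (trans (cl-* (- + 1) x) (cong (_⊗ cl x) (cl-unique 3 (- + 1) refl)))

even-or-odd : ∀ x → ∃ λ k → x ≡ k + k ⊎ x ≡ k + k + + 1
even-or-odd x with x %ℕ 2 | n%ℕd<d x 2 | a≡a%ℕn+[a/ℕn]*n x 2
... | 0 | _ | eq = x /ℕ 2 , inj₁ (trans eq (double (x /ℕ 2)))
  where
  double : ∀ k → + 0 + k * + 2 ≡ k + k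
  double = solve-∀
... | 1 | _ | eq = x /ℕ 2 , inj₂ (trans eq (double+1 (x /ℕ 2)))
  where
  double+1 : ∀ k → + 1 + k * + 2 ≡ k + k + + 1
  double+1 = solve-∀
... | ℕ.suc (ℕ.suc _) | ℕ.s≤s (ℕ.s≤s ()) | _

-- χ r and ρ r are the imaginary and the real part of the fourth root of unity i ^ r.
χ ρ odd even two : ℤ₄ → ℤ
χ 0F = + 0
χ 1F = + 1
χ 2F = + 0
χ 3F = - + 1
ρ 0F = + 1
ρ 1F = + 0
ρ 2F = - + 1
ρ 3F = + 0
odd 0F = + 0
odd 1F = + 1
odd 2F = + 0
odd 3F = + 1
even 0F = + 1
even 1F = + 0
even 2F = + 1
even 3F = + 0
two 0F = + 0
two 1F = + 0
two 2F = + 1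
two 3F = + 0

-- The factors belong to θ₁′ (without its coefficient m), θ₂, θ₃ and θ₄ in this order.
weight₄ : ℤ₄ → ℤ₄ → ℤ₄ → ℤ₄ → ℤ
weight₄ m a b c = χ m * odd a * even b * ρ c

sym₄ : ℤ₄ → ℤ₄ → ℤ₄ → ℤ₄ → ℤ
sym₄ m a b c = weight₄ m a b c + weight₄ c b a m

by-cases₄ : {f g : ℤ₄ → ℤ₄ → ℤ₄ → ℤ₄ → ℤ} →
  {True (FinP.all? λ a → FinP.all? λ b → FinP.all? λ c → FinP.all? λ d → f a b c d ℤ.≟ g a b c d)} →
  ∀ a b c d → f a b c d ≡ g a b c d
by-cases₄ {_} {_} {t} = toWitness t

-- With k as a coordinate, both m = 2k + a + b + c and its reflection k + a + b + c are polynomial,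
-- so residues modulo 4 of k, a, b, c decide everything and no halving of residues occurs.
sym₄-reflect : ∀ k a b c → sym₄ (k ⊕ k ⊕ a ⊕ b ⊕ c) a b c ≡ sym₄ (k ⊕ a ⊕ b ⊕ c) (a ⊕ k) (b ⊕ k) (c ⊕ k)
sym₄-reflect = by-cases₄

-- Either summand of `sym₄` is supported on vectors with exactly two odd coordinates, whose sum is
-- even. Hence nothing is lost by restricting to the image of `embed`.
sym₄-odd-sum : ∀ k a b c → sym₄ (k ⊕ k ⊕ 1F ⊕ a ⊕ b ⊕ c) a b c ≡ + 0
sym₄-odd-sum = by-cases₄

-- Enumerations of the solutions of quadratic equations

interval : ∀ B → Enumeration (λ x → ∣ x ∣ ℕ.≤ B)
interval B = record
  { elements = range B
  ; unique   = Uniq.map⁺ (λ {i} {j} eq → ℤP.+-injective (∙-cancelʳ (- + B) (+ i) (+ j) eq)) (Uniq.upTo⁺ (ℕ.suc (2 ℕ.* B)))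
  ; sound    = λ x∈ → let i , i∈ , eq = ∈-map⁻ _ x∈ in subst (λ x → ∣ x ∣ ℕ.≤ B) (sym eq) (bounded i (ℕP.m<1+n⇒m≤n (∈-upTo⁻ i∈)))
  ; complete = λ {x} → member x
  }
  where
  bounded : ∀ i → i ℕ.≤ 2 ℕ.* B → ∣ + i - + B ∣ ℕ.≤ B
  bounded i i≤2B rewrite ℤP.m-n≡m⊖n i B with ℕP.≤-total i B
  ... | inj₁ i≤B rewrite ℤP.∣⊖∣-≤ i≤B = ℕP.m∸n≤m B i
  ... | inj₂ B≤i rewrite ℤP.⊖-≥ B≤i   =
    ℕP.m≤n+o⇒m∸n≤o i B (subst (i ℕ.≤_) (cong (B ℕ.+_) (ℕP.+-identityʳ B)) i≤2B)
  at : ∀ {x} i → i ℕ.≤ 2 ℕ.* B → x ≡ + i - + B → x ∈ range B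
  at i i≤ refl = ∈-map⁺ _ (∈-upTo⁺ (ℕ.s≤s i≤))
  add-sub : ∀ x y → x ≡ x + y - y
  add-sub = solve-∀
  member : ∀ x → ∣ x ∣ ℕ.≤ B → x ∈ range B
  member (+ n) n≤B = at (n ℕ.+ B)
    (subst (n ℕ.+ B ℕ.≤_) (cong (B ℕ.+_) (sym (ℕP.+-identityʳ B))) (ℕP.+-monoˡ-≤ B n≤B))
    (add-sub (+ n) (+ B))
  member -[1+ n ] n<B = at (B ℕ.∸ ℕ.suc n) (ℕP.≤-trans (ℕP.m∸n≤m B (ℕ.suc n)) (ℕP.m≤m+n B _))
    (trans (add-sub -[1+ n ] (+ B)) (cong (_- + B)
      (trans (ℤP.+-comm -[1+ n ] (+ B)) (ℤP.⊖-≥ n<B))))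

form : ℕ → ℕ → ℕ → ℤ × ℤ × ℤ → ℤ
form α β γ (x , y , z) = + α * (x * x) + + β * (y * y) + + γ * (z * z)

abs-square : ∀ x → x * x ≡ + (∣ x ∣ ℕ.* ∣ x ∣)
abs-square (+ n)    = sym (ℤP.pos-* n n)
abs-square -[1+ n ] = refl

formᴺ : ℕ → ℕ → ℕ → ℤ × ℤ × ℤ → ℕ
formᴺ α β γ (x , y , z) = α ℕ.* (∣ x ∣ ℕ.* ∣ x ∣) ℕ.+ β ℕ.* (∣ y ∣ ℕ.* ∣ y ∣) ℕ.+ γ ℕ.* (∣ z ∣ ℕ.* ∣ z ∣)

form-natural : ∀ α β γ v → form α β γ v ≡ + formᴺ α β γ v
form-natural α β γ (x , y , z) = cong₂ _+_ (cong₂ _+_ (term α x) (term β y)) (term γ z)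
  where
  term : ∀ α x → + α * (x * x) ≡ + (α ℕ.* (∣ x ∣ ℕ.* ∣ x ∣))
  term α x = trans (cong (+ α *_) (abs-square x)) (sym (ℤP.pos-* α _))

n≤n*n : ∀ n → n ℕ.≤ n ℕ.* n
n≤n*n ℕ.zero    = ℕ.z≤n
n≤n*n (ℕ.suc n) = ℕP.m≤m*n (ℕ.suc n) (ℕ.suc n)

Three : ℕ → ℕ → ℕ → ℕ → ℤ × ℤ × ℤ → Set
Three α β γ n v = form α β γ v ≡ + n

Box : ℕ → ℤ × ℤ × ℤ → Set
Box B (x , y , z) = ∣ x ∣ ℕ.≤ B × ∣ y ∣ ℕ.≤ B × ∣ z ∣ ℕ.≤ B

box : ∀ B → Enumeration (Box B)
box B = pairs (interval B) (pairs (interval B) (interval B))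

module _ (α β γ : ℕ) .{{_ : ℕ.NonZero α}} .{{_ : ℕ.NonZero β}} .{{_ : ℕ.NonZero γ}} where

  formᴺ-bounded : ∀ v → Box (formᴺ α β γ v) v
  formᴺ-bounded (x , y , z) =
      ℕP.≤-trans (term α x) (ℕP.≤-trans (ℕP.m≤m+n _ _) (ℕP.m≤m+n _ _))
    , ℕP.≤-trans (term β y) (ℕP.≤-trans (ℕP.m≤n+m _ (α ℕ.* (∣ x ∣ ℕ.* ∣ x ∣))) (ℕP.m≤m+n _ _))
    , ℕP.≤-trans (term γ z) (ℕP.m≤n+m _ _)
    where
    term : ∀ α .{{_ : ℕ.NonZero α}} x → ∣ x ∣ ℕ.≤ α ℕ.* (∣ x ∣ ℕ.* ∣ x ∣)
    term α x = ℕP.≤-trans (n≤n*n ∣ x ∣) (ℕP.m≤n*m _ α)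

  Three⊆Box : ∀ {n} v → Three α β γ n v → Box n v
  Three⊆Box v p = subst (λ n → Box n v) (ℤP.+-injective (trans (sym (form-natural α β γ v)) p)) (formᴺ-bounded v)

  three : ∀ n → Enumeration (Three α β γ n)
  three n = subset (λ v → form α β γ v ℤ.≟ + n) Three⊆Box (box n)

Square : ℕ → ℤ → Set
Square i m = m * m ≡ + i

Square-bounded : ∀ {i} m → Square i m → ∣ m ∣ ℕ.≤ i
Square-bounded m p = subst (∣ m ∣ ℕ.≤_) (ℤP.+-injective (trans (sym (abs-square m)) p)) (n≤n*n ∣ m ∣)

square : ∀ i → Enumeration (Square i)
square i = subset (λ m → m * m ℤ.≟ + i) Square-bounded (interval i)

ℤ⁴ : Set
ℤ⁴ = ℤ × ℤ × ℤ × ℤ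

norm : ℤ⁴ → ℤ
norm (m , v) = m * m + form 1 1 1 v

Four : ℕ → ℤ⁴ → Set
Four L x = norm x ≡ + L

Four⇒ℕ : ∀ {L} m v → Four L (m , v) → ∣ m ∣ ℕ.* ∣ m ∣ ℕ.+ formᴺ 1 1 1 v ≡ L
Four⇒ℕ m v p = ℤP.+-injective (trans (sym (cong₂ _+_ (abs-square m) (form-natural 1 1 1 v))) p)

Four⊆box : ∀ {L} x → Four L x → (∣ proj₁ x ∣ ℕ.≤ L) × Box L (proj₂ x)
Four⊆box {L} (m , v) p =
    ℕP.≤-trans (n≤n*n ∣ m ∣) (ℕP.≤-trans (ℕP.m≤m+n _ _) le)
  , let x≤ , y≤ , z≤ = formᴺ-bounded 1 1 1 v
        up = λ {k} (k≤ : k ℕ.≤ formᴺ 1 1 1 v) → ℕP.≤-trans k≤ (ℕP.≤-trans (ℕP.m≤n+m _ (∣ m ∣ ℕ.* ∣ m ∣)) le)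
    in up x≤ , up y≤ , up z≤
  where
  le : ∣ m ∣ ℕ.* ∣ m ∣ ℕ.+ formᴺ 1 1 1 v ℕ.≤ L
  le = ℕP.≤-reflexive (Four⇒ℕ m v p)

four : ∀ L → Enumeration (Four L)
four L = subset (λ x → norm x ℤ.≟ + L) Four⊆box (pairs (interval L) (box L))

-- The coordinates k = (m - a - b - c) / 2, a, b, c on the vectors with even coordinate sum, where the
-- reflection in the hyperplane m = a + b + c is polynomial.
embed reflect : ℤ⁴ → ℤ⁴
embed   (k , a , b , c) = k + k + a + b + c , a , b , c
reflect (k , a , b , c) = - k , a + k , b + k , c + k

reflect-involutive : ∀ x → reflect (reflect x) ≡ x
reflect-involutive (k , a , b , c) =
  cong₂ _,_ (ℤP.neg-involutive k) (cong₂ _,_ (cancel a k) (cong₂ _,_ (cancel b k) (cancel c k)))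
  where
  cancel : ∀ a k → a + k + - k ≡ a
  cancel = solve-∀

norm-reflect : ∀ x → norm (embed (reflect x)) ≡ norm (embed x)
norm-reflect (k , a , b , c) = identity k a b c
  where
  identity : ∀ k a b c →
    let m  = k + k + a + b + c
        m′ = - k + - k + (a + k) + (b + k) + (c + k)
    in m′ * m′ + (+ 1 * ((a + k) * (a + k)) + + 1 * ((b + k) * (b + k)) + + 1 * ((c + k) * (c + k)))
       ≡ m * m + (+ 1 * (a * a) + + 1 * (b * b) + + 1 * (c * c))
  identity = solve-∀

EvenFour : ℕ → ℤ⁴ → Set
EvenFour L x = Four L (embed x)

evenFour : ∀ L → Enumeration (EvenFour L)
evenFour L = subset (λ x → norm (embed x) ℤ.≟ + L) bounded (pairs (interval (L ℕ.+ L)) (box L))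
  where
  -- k is the difference of the first coordinates of the vector and of its reflection. Both vectors
  -- have norm L, whence the bound L + L.
  difference : ∀ k a b c → k + k + a + b + c - (- k + - k + (a + k) + (b + k) + (c + k)) ≡ k
  difference = solve-∀
  bounded : ∀ x → EvenFour L x → (∣ proj₁ x ∣ ℕ.≤ L ℕ.+ L) × Box L (proj₂ x)
  bounded x@(k , a , b , c) p =
      subst (λ z → ∣ z ∣ ℕ.≤ L ℕ.+ L) (difference k a b c)
        (ℕP.≤-trans (ℤP.∣i-j∣≤∣i∣+∣j∣ (proj₁ (embed x)) (proj₁ (embed (reflect x))))
          (ℕP.+-mono-≤ (proj₁ (Four⊆box (embed x) p))
                       (proj₁ (Four⊆box (embed (reflect x)) (trans (norm-reflect x) p)))))
    , proj₂ (Four⊆box (embed x) p)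

-- The reflection identity in four variables

weight symWeight : ℤ⁴ → ℤ
weight    (m , a , b , c) = weight₄ (cl m) (cl a) (cl b) (cl c)
symWeight (m , a , b , c) = sym₄ (cl m) (cl a) (cl b) (cl c)

cong₄ : ∀ (f : ℤ₄ → ℤ₄ → ℤ₄ → ℤ₄ → ℤ) {m m′ a a′ b b′ c c′} →
  m ≡ m′ → a ≡ a′ → b ≡ b′ → c ≡ c′ → f m a b c ≡ f m′ a′ b′ c′
cong₄ f refl refl refl refl = refl

cl-+₄ : ∀ k a b c → cl (k + a + b + c) ≡ cl k ⊕ cl a ⊕ cl b ⊕ cl c
cl-+₄ k a b c = trans (cl-+ (k + a + b) c) (cong (_⊕ cl c)
  (trans (cl-+ (k + a) b) (cong (_⊕ cl b) (cl-+ k a))))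

symWeight-reflect : ∀ x → symWeight (embed (reflect x)) ≡ symWeight (embed x)
symWeight-reflect (k , a , b , c) = begin
  symWeight (embed (reflect (k , a , b , c)))
    ≡⟨ cong₄ sym₄ (trans (cong cl (half-sum k a b c)) (cl-+₄ k a b c)) (cl-+ a k) (cl-+ b k) (cl-+ c k) ⟩
  sym₄ (cl k ⊕ cl a ⊕ cl b ⊕ cl c) (cl a ⊕ cl k) (cl b ⊕ cl k) (cl c ⊕ cl k)
    ≡⟨ sym₄-reflect (cl k) (cl a) (cl b) (cl c) ⟨
  sym₄ (cl k ⊕ cl k ⊕ cl a ⊕ cl b ⊕ cl c) (cl a) (cl b) (cl c)
    ≡⟨ cong (λ m → sym₄ m (cl a) (cl b) (cl c))
         (trans (cl-+₄ (k + k) a b c) (cong (λ z → z ⊕ cl a ⊕ cl b ⊕ cl c) (cl-+ k k))) ⟨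
  symWeight (embed (k , a , b , c)) ∎
  where
  open ≡-Reasoning
  half-sum : ∀ k a b c → - k + - k + (a + k) + (b + k) + (c + k) ≡ k + a + b + c
  half-sum = solve-∀

symWeight-odd-sum : ∀ k a b c → symWeight (k + k + + 1 + a + b + c , a , b , c) ≡ + 0
symWeight-odd-sum k a b c = trans
  (cong (λ m → sym₄ m (cl a) (cl b) (cl c)) (trans (cl-+₄ (k + k + + 1) a b c)
    (cong (λ z → z ⊕ cl a ⊕ cl b ⊕ cl c) (trans (cl-+ (k + k) (+ 1)) (cong₂ _⊕_ (cl-+ k k) (cl-const 1))))))
  (sym₄-odd-sum (cl k) (cl a) (cl b) (cl c))

embed-or-odd : ∀ x → (∃ λ y → x ≡ embed y) ⊎ symWeight x ≡ + 0
embed-or-odd (m , a , b , c) = decide (even-or-odd (m - a - b - c))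
  where
  add-back : ∀ m a b c → m ≡ m - a - b - c + a + b + c
  add-back = solve-∀
  m≡ : ∀ {d} → m - a - b - c ≡ d → m ≡ d + a + b + c
  m≡ eq = trans (add-back m a b c) (cong (λ z → z + a + b + c) eq)
  decide : (∃ λ k → m - a - b - c ≡ k + k ⊎ m - a - b - c ≡ k + k + + 1) →
    (∃ λ y → (m , a , b , c) ≡ embed y) ⊎ symWeight (m , a , b , c) ≡ + 0
  decide (k , inj₁ eq) = inj₁ ((k , a , b , c) , cong (_, a , b , c) (m≡ eq))
  decide (k , inj₂ eq) = inj₂ (trans (cong (λ z → symWeight (z , a , b , c)) (m≡ eq)) (symWeight-odd-sum k a b c))

-- Cubic moments over the vectors of given norm

cube : ℤ → ℤ
cube z = z * z * z

-- Twice the first coordinate of the reflected vector; working with it avoids denominators and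
-- causes the factor 8 = 2³ in `reflected`.
total : ℤ⁴ → ℤ
total (m , a , b , c) = m + a + b + c

negᵐ negᵃ negᵇ negᶜ swap₄ : ℤ⁴ → ℤ⁴
negᵐ  (m , a , b , c) = - m , a , b , c
negᵃ  (m , a , b , c) = m , - a , b , c
negᵇ  (m , a , b , c) = m , a , - b , c
negᶜ  (m , a , b , c) = m , a , b , - c
swap₄ (m , a , b , c) = c , b , a , m

neg-square : ∀ x → - x * - x ≡ x * x
neg-square = solve-∀

negᵐ-norm : ∀ x → norm (negᵐ x) ≡ norm x
negᵐ-norm (m , v) = cong (_+ form 1 1 1 v) (neg-square m)

negᵃ-norm : ∀ x → norm (negᵃ x) ≡ norm x
negᵃ-norm (m , a , b , c) = cong (λ z → m * m + (+ 1 * z + + 1 * (b * b) + + 1 * (c * c))) (neg-square a)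

negᵇ-norm : ∀ x → norm (negᵇ x) ≡ norm x
negᵇ-norm (m , a , b , c) = cong (λ z → m * m + (+ 1 * (a * a) + + 1 * z + + 1 * (c * c))) (neg-square b)

negᶜ-norm : ∀ x → norm (negᶜ x) ≡ norm x
negᶜ-norm (m , a , b , c) = cong (λ z → m * m + (+ 1 * (a * a) + + 1 * (b * b) + + 1 * z)) (neg-square c)

swap₄-norm : ∀ x → norm (swap₄ x) ≡ norm x
swap₄-norm (m , a , b , c) = identity m a b c
  where
  identity : ∀ m a b c → c * c + (+ 1 * (b * b) + + 1 * (a * a) + + 1 * (m * m))
                       ≡ m * m + (+ 1 * (a * a) + + 1 * (b * b) + + 1 * (c * c))
  identity = solve-∀

weight₄-negᵃ : ∀ m a b c → weight₄ m (3F ⊗ a) b c ≡ weight₄ m a b c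
weight₄-negᵃ = by-cases₄

weight₄-negᵇ : ∀ m a b c → weight₄ m a (3F ⊗ b) c ≡ weight₄ m a b c
weight₄-negᵇ = by-cases₄

weight₄-negᶜ : ∀ m a b c → weight₄ m a b (3F ⊗ c) ≡ weight₄ m a b c
weight₄-negᶜ = by-cases₄

negᵃ-weight : ∀ x → weight (negᵃ x) ≡ weight x
negᵃ-weight (m , a , b , c) = trans (cong (λ z → weight₄ (cl m) z (cl b) (cl c)) (cl-neg a)) (weight₄-negᵃ (cl m) (cl a) (cl b) (cl c))

negᵇ-weight : ∀ x → weight (negᵇ x) ≡ weight x
negᵇ-weight (m , a , b , c) = trans (cong (λ z → weight₄ (cl m) (cl a) z (cl c)) (cl-neg b)) (weight₄-negᵇ (cl m) (cl a) (cl b) (cl c))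

negᶜ-weight : ∀ x → weight (negᶜ x) ≡ weight x
negᶜ-weight (m , a , b , c) = trans (cong (λ z → weight₄ (cl m) (cl a) (cl b) z) (cl-neg c)) (weight₄-negᶜ (cl m) (cl a) (cl b) (cl c))

-- After the swap m stands in the slot of `ρ`, which is an even function.
negᵐ-weight : ∀ x → weight (swap₄ (negᵐ x)) ≡ weight (swap₄ x)
negᵐ-weight (m , a , b , c) = negᶜ-weight (c , b , a , m)

self-negative : ∀ z → z ≡ - + 1 * z → z ≡ + 0
self-negative z eq = ℤP.*-cancelˡ-≡ (+ 2) z (+ 0) (trans (double z) (trans (cong (λ y → z + y) eq) (cancel z)))
  where
  double : ∀ z → + 2 * z ≡ z + z
  double = solve-∀
  cancel : ∀ z → z + - + 1 * z ≡ + 0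
  cancel = solve-∀

module _ (L : ℕ) where

  private
    ⟨_⟩ : (ℤ⁴ → ℤ) → ℤ
    ⟨ F ⟩ = ∑[ four L ] F

    ⟨⟩-cong : ∀ {F G} → (∀ x → F x ≡ G x) → ⟨ F ⟩ ≡ ⟨ G ⟩
    ⟨⟩-cong eq = ∑[]-cong (four L) (λ x _ → eq x)

    ⟨⟩-+ : ∀ F G → ⟨ (λ x → F x + G x) ⟩ ≡ ⟨ F ⟩ + ⟨ G ⟩
    ⟨⟩-+ = ∑-+ (elements (four L))

    ⟨⟩-* : ∀ k F → ⟨ (λ x → k * F x) ⟩ ≡ k * ⟨ F ⟩
    ⟨⟩-* = ∑-*ˡ (elements (four L))

    ⟨⟩-involution : ∀ (σ : ℤ⁴ → ℤ⁴) {F G} → (∀ x → σ (σ x) ≡ x) → (∀ x → norm (σ x) ≡ norm x) →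
      (∀ x → F x ≡ G (σ x)) → ⟨ F ⟩ ≡ ⟨ G ⟩
    ⟨⟩-involution σ σσ σ-norm eq =
      ∑[]-involution (four L) σ σσ (λ x p → trans (σ-norm x) p) (λ x _ → eq x)

    symmetrise : (ℤ⁴ → ℤ⁴) → (ℤ⁴ → ℤ) → ℤ⁴ → ℤ
    symmetrise σ F x = F x + F (σ x)

    -- Since σ preserves norm and weight, `F` and `F ∘ σ` have the same weighted sum.
    ⟨⟩-symmetrise : ∀ (σ : ℤ⁴ → ℤ⁴) F → (∀ x → σ (σ x) ≡ x) → (∀ x → norm (σ x) ≡ norm x) →
      (∀ x → weight (σ x) ≡ weight x) →
      + 2 * ⟨ (λ x → weight x * F x) ⟩ ≡ ⟨ (λ x → weight x * symmetrise σ F x) ⟩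
    ⟨⟩-symmetrise σ F σσ σ-norm σ-weight = sym (begin
      ⟨ (λ x → weight x * symmetrise σ F x) ⟩              ≡⟨ ⟨⟩-cong (λ x → ℤP.*-distribˡ-+ (weight x) (F x) (F (σ x))) ⟩
      ⟨ (λ x → weight x * F x + weight x * F (σ x)) ⟩      ≡⟨ ⟨⟩-+ _ _ ⟩
      S + ⟨ (λ x → weight x * F (σ x)) ⟩                   ≡⟨ cong (λ z → S + z) (⟨⟩-involution σ σσ σ-norm (λ x → cong (_* F (σ x)) (sym (σ-weight x)))) ⟩
      S + S                                                ≡⟨ double S ⟩
      + 2 * S                                              ∎)
      where
      open ≡-Reasoning
      S = ⟨ (λ x → weight x * F x) ⟩
      double : ∀ s → s + s ≡ + 2 * s
      double = solve-∀

    A B C : ℤ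
    A = ⟨ (λ x → weight x * cube (proj₁ x)) ⟩
    B = ⟨ (λ (m , v) → weight (m , v) * (m * form 1 1 1 v)) ⟩
    C = ⟨ (λ x → weight x * cube (total x)) ⟩

    onto : ∀ {F : ℤ⁴ → ℤ} x → Four L x → (∃ λ y → EvenFour L y × x ≡ embed y) ⊎ symWeight x * F x ≡ + 0
    onto {F} x p with embed-or-odd x
    ... | inj₁ (y , refl) = inj₁ (y , p , refl)
    ... | inj₂ z          = inj₂ (cong (_* F x) z)

    embed-injective : ∀ {x y} → embed x ≡ embed y → x ≡ y
    embed-injective {k , a , b , c} {k′ , _} eq with cong proj₂ eq | cong proj₁ eq
    ... | refl | eq′ = cong (_, a , b , c) (ℤP.*-cancelʳ-≡ k k′ (+ 2)
      (trans (double k a b c) (trans (cong (λ z → z - a - b - c) eq′) (sym (double k′ a b c)))))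
      where
      double : ∀ k a b c → k * + 2 ≡ k + k + a + b + c - a - b - c
      double = solve-∀

    even-part : ∀ (F : ℤ⁴ → ℤ) → ∑[ evenFour L ] (λ x → symWeight (embed x) * F (embed x)) ≡ ⟨ (λ x → symWeight x * F x) ⟩
    even-part F = ∑[]-reindex (evenFour L) (four L) embed
      (λ _ p → p) (λ _ _ → embed-injective) (onto {F}) (λ _ _ → refl)

    reflected : + 8 * ⟨ (λ x → symWeight x * cube (proj₁ x)) ⟩ ≡ ⟨ (λ x → symWeight x * cube (total x)) ⟩
    reflected = begin
      + 8 * ⟨ (λ x → symWeight x * cube (proj₁ x)) ⟩
        ≡⟨ cong (+ 8 *_) (even-part (cube ∘ proj₁)) ⟨
      + 8 * ∑[ evenFour L ] (λ x → symWeight (embed x) * cube (proj₁ (embed x)))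
        ≡⟨ cong (+ 8 *_) (∑[]-involution (evenFour L) reflect reflect-involutive (λ x p → trans (norm-reflect x) p)
            (λ x _ → cong₂ (λ y z → y * cube (proj₁ z)) (sym (symWeight-reflect x)) (cong embed (sym (reflect-involutive x))))) ⟩
      + 8 * ∑[ evenFour L ] (λ x → symWeight (embed x) * cube (proj₁ (embed (reflect x))))
        ≡⟨ ∑-*ˡ (elements (evenFour L)) (+ 8) _ ⟨
      ∑[ evenFour L ] (λ x → + 8 * (symWeight (embed x) * cube (proj₁ (embed (reflect x)))))
        ≡⟨ ∑[]-cong (evenFour L) (λ (k , a , b , c) _ → doubled (symWeight (embed (k , a , b , c))) k a b c) ⟩
      ∑[ evenFour L ] (λ x → symWeight (embed x) * cube (total (embed x)))
        ≡⟨ even-part (cube ∘ total) ⟩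
      ⟨ (λ x → symWeight x * cube (total x)) ⟩ ∎
      where
      open ≡-Reasoning
      doubled : ∀ w k a b c →
        let s = - k + - k + (a + k) + (b + k) + (c + k)
            t = k + k + a + b + c + a + b + c
        in + 8 * (w * (s * s * s)) ≡ w * (t * t * t)
      doubled = solve-∀

    split : ∀ (F : ℤ⁴ → ℤ) → ⟨ (λ x → symWeight x * F x) ⟩ ≡ ⟨ (λ x → weight x * F x) ⟩ + ⟨ (λ x → weight (swap₄ x) * F x) ⟩
    split F = trans (⟨⟩-cong (λ x → ℤP.*-distribʳ-+ (F x) (weight x) (weight (swap₄ x)))) (⟨⟩-+ _ _)

    swapped-cube : ⟨ (λ x → weight (swap₄ x) * cube (proj₁ x)) ⟩ ≡ + 0
    swapped-cube = self-negative _ (trans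
      (⟨⟩-involution negᵐ (λ (m , v) → cong (_, v) (ℤP.neg-involutive m)) negᵐ-norm
        (λ x@(m , _) → trans (odd-cube (weight (swap₄ x)) m) (cong (λ w → - + 1 * (w * cube (- m))) (sym (negᵐ-weight x)))))
      (⟨⟩-* (- + 1) _))
      where
      odd-cube : ∀ w m → w * (m * m * m) ≡ - + 1 * (w * (- m * - m * - m))
      odd-cube = solve-∀

    swapped-total : ⟨ (λ x → weight (swap₄ x) * cube (total x)) ⟩ ≡ C
    swapped-total = ⟨⟩-involution swap₄ (λ _ → refl) swap₄-norm
      (λ x@(m , a , b , c) → cong (λ z → weight (swap₄ x) * cube z) (reverse m a b c))
      where
      reverse : ∀ m a b c → m + a + b + c ≡ c + b + a + m
      reverse = solve-∀

    8A≡2C : + 8 * A ≡ C + C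
    8A≡2C = begin
      + 8 * A                                                  ≡⟨ cong (+ 8 *_) (ℤP.+-identityʳ A) ⟨
      + 8 * (A + + 0)                                          ≡⟨ cong (λ z → + 8 * (A + z)) swapped-cube ⟨
      + 8 * (A + _)                                            ≡⟨ cong (+ 8 *_) (split (cube ∘ proj₁)) ⟨
      + 8 * ⟨ (λ x → symWeight x * cube (proj₁ x)) ⟩           ≡⟨ reflected ⟩
      ⟨ (λ x → symWeight x * cube (total x)) ⟩                 ≡⟨ split (cube ∘ total) ⟩
      C + _                                                    ≡⟨ cong (λ z → C + z) swapped-total ⟩
      C + C                                                    ∎
      where open ≡-Reasoning

    -- Each sign change doubles the sum and removes the monomials odd in that variable. Of the cube
    -- only m³ + 3m (a² + b² + c²) survives, eight times.
    8C≡8A+24B : + 2 * (+ 2 * (+ 2 * C)) ≡ + 8 * A + + 24 * B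
    8C≡8A+24B = begin
      + 2 * (+ 2 * (+ 2 * C))
        ≡⟨ cong (λ z → + 2 * (+ 2 * z)) (⟨⟩-symmetrise negᶜ (cube ∘ total) (λ (m , a , b , c) → cong (λ z → m , a , b , z) (ℤP.neg-involutive c)) negᶜ-norm negᶜ-weight) ⟩
      + 2 * (+ 2 * ⟨ (λ x → weight x * F₁ x) ⟩)
        ≡⟨ cong (+ 2 *_) (⟨⟩-symmetrise negᵇ F₁ (λ (m , a , b , c) → cong (λ z → m , a , z , c) (ℤP.neg-involutive b)) negᵇ-norm negᵇ-weight) ⟩
      + 2 * ⟨ (λ x → weight x * F₂ x) ⟩
        ≡⟨ ⟨⟩-symmetrise negᵃ F₂ (λ (m , a , b , c) → cong (λ z → m , z , b , c) (ℤP.neg-involutive a)) negᵃ-norm negᵃ-weight ⟩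
      ⟨ (λ x → weight x * symmetrise negᵃ F₂ x) ⟩
        ≡⟨ ⟨⟩-cong (λ x@(m , a , b , c) → eight-cubes (weight x) m a b c) ⟩
      ⟨ (λ x@(m , v) → + 8 * (weight x * cube m) + + 24 * (weight x * (m * form 1 1 1 v))) ⟩
        ≡⟨ ⟨⟩-+ _ _ ⟩
      ⟨ (λ x → + 8 * (weight x * cube (proj₁ x))) ⟩ + ⟨ (λ x@(m , v) → + 24 * (weight x * (m * form 1 1 1 v))) ⟩
        ≡⟨ cong₂ _+_ (⟨⟩-* (+ 8) _) (⟨⟩-* (+ 24) _) ⟩
      + 8 * A + + 24 * B ∎
      where
      open ≡-Reasoning
      F₁ = symmetrise negᶜ (cube ∘ total)
      F₂ = symmetrise negᵇ F₁
      cubes : ∀ m a b c →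
        let p = m + a + b + c
            q = m + a + b + - c
            r = m + a + - b + c
            s = m + a + - b + - c
            t = m + - a + b + c
            u = m + - a + b + - c
            v = m + - a + - b + c
            w = m + - a + - b + - c
        in p * p * p + q * q * q + (r * r * r + s * s * s) + (t * t * t + u * u * u + (v * v * v + w * w * w))
           ≡ + 8 * (m * m * m) + + 24 * (m * (+ 1 * (a * a) + + 1 * (b * b) + + 1 * (c * c)))
      cubes = solve-∀
      distribute : ∀ w y z → w * (+ 8 * y + + 24 * z) ≡ + 8 * (w * y) + + 24 * (w * z)
      distribute = solve-∀
      eight-cubes : ∀ w m a b c → w * symmetrise negᵃ F₂ (m , a , b , c)
        ≡ + 8 * (w * cube m) + + 24 * (w * (m * form 1 1 1 (a , b , c)))
      eight-cubes w m a b c = trans (cong (w *_) (cubes m a b c)) (distribute w (cube m) _)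

  weighted-harmonic : ∑[ four L ] (λ (m , v) → weight (m , v) * (m * (m * m - form 1 1 1 v))) ≡ + 0
  weighted-harmonic = begin
    ⟨ (λ (m , v) → weight (m , v) * (m * (m * m - form 1 1 1 v))) ⟩
      ≡⟨ ⟨⟩-cong (λ (m , v) → expand (weight (m , v)) m (form 1 1 1 v)) ⟩
    ⟨ (λ (m , v) → weight (m , v) * cube m + - + 1 * (weight (m , v) * (m * form 1 1 1 v))) ⟩
      ≡⟨ trans (⟨⟩-+ _ _) (cong (λ z → A + z) (⟨⟩-* (- + 1) _)) ⟩
    A + - + 1 * B
      ≡⟨ ℤP.*-cancelˡ-≡ (+ 24) _ (+ 0) (combine A B C 8A≡2C 8C≡8A+24B) ⟩
    + 0 ∎
    where
    open ≡-Reasoning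
    expand : ∀ w m n → w * (m * (m * m - n)) ≡ w * (m * m * m) + - + 1 * (w * (m * n))
    expand = solve-∀
    combine : ∀ a b c → + 8 * a ≡ c + c → + 2 * (+ 2 * (+ 2 * c)) ≡ + 8 * a + + 24 * b → + 24 * (a + - + 1 * b) ≡ + 0
    -- 24 (A - B) is written as 4 · 8A - (8A + 24B), which becomes 8C - 8C.
    combine a b c p q = trans (regroup a b) (trans (cong₂ (λ y z → + 4 * y - z) p (sym q)) (cancel c))
      where
      regroup : ∀ a b → + 24 * (a + - + 1 * b) ≡ + 4 * (+ 8 * a) - (+ 8 * a + + 24 * b)
      regroup = solve-∀
      cancel : ∀ c → + 4 * (c + c) - + 2 * (+ 2 * (+ 2 * c)) ≡ + 0
      cancel = solve-∀

-- Jacobi's derivative formula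

∑[]-pairs : ∀ {X Y : Set} {P : X → Set} {Q : Y → Set} (E : Enumeration P) (E′ : Enumeration Q) (F : X → ℤ) (G : Y → ℤ) →
  ∑[ pairs E E′ ] (λ (x , y) → F x * G y) ≡ ∑[ E ] F * ∑[ E′ ] G
∑[]-pairs E E′ F G = begin
  ∑[ pairs E E′ ] (λ (x , y) → F x * G y)        ≡⟨ ∑[]-dependentPairs E (λ _ → E′) _ ⟩
  ∑[ E ] (λ x → ∑[ E′ ] (λ y → F x * G y))       ≡⟨ ∑[]-cong E (λ x _ → trans (∑-*ˡ (elements E′) (F x) G) (ℤP.*-comm (F x) _)) ⟩
  ∑[ E ] (λ x → ∑[ E′ ] G * F x)                 ≡⟨ ∑-*ˡ (elements E) (∑[ E′ ] G) F ⟩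
  ∑[ E′ ] G * ∑[ E ] F                           ≡⟨ ℤP.*-comm (∑[ E′ ] G) _ ⟩
  ∑[ E ] F * ∑[ E′ ] G                           ∎
  where open ≡-Reasoning

antidiagonal : ∀ L → Enumeration (λ ((i , j) : ℕ × ℕ) → i ℕ.+ j ≡ L)
antidiagonal L = record
  { elements = map (λ i → i , L ℕ.∸ i) (upTo (ℕ.suc L))
  ; unique   = Uniq.map⁺ (cong proj₁) (Uniq.upTo⁺ (ℕ.suc L))
  ; sound    = λ x∈ → let i , i∈ , eq = ∈-map⁻ _ x∈ in
      subst (λ (i , j) → i ℕ.+ j ≡ L) (sym eq) (ℕP.m+[n∸m]≡n (ℕP.m<1+n⇒m≤n (∈-upTo⁻ i∈)))
  ; complete = λ { {i , j} refl → subst (λ k → (i , k) ∈′ (i ℕ.+ j)) (ℕP.m+n∸m≡n i j)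
      (∈-map⁺ _ (∈-upTo⁺ (ℕ.s≤s (ℕP.m≤m+n i j)))) }
  }
  where
  _∈′_ : ℕ × ℕ → ℕ → Set
  x ∈′ L = x ∈ map (λ i → i , L ℕ.∸ i) (upTo (ℕ.suc L))

-- Coefficients of θ₁′ and of θ₂θ₃θ₄ at nome q⁴, where the exponents m² and a² + b² + c² are
-- integers.
jacobi thetas : ℕ → ℤ
jacobi i = ∑[ square i ] (λ m → χ (cl m) * m)
thetas j = ∑[ three 1 1 1 j ] (λ (a , b , c) → odd (cl a) * even (cl b) * ρ (cl c))

-- A square root of i together with a representation of j by three squares, over all i + j = L, is a
-- vector of norm L, and i - j is m² - a² - b² - c² there.
wronskian : ∀ L → ∑[ antidiagonal L ] (λ (i , j) → (+ i - + j) * (jacobi i * thetas j)) ≡ + 0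
wronskian L = begin
  ∑[ antidiagonal L ] (λ (i , j) → (+ i - + j) * (jacobi i * thetas j))
    ≡⟨ ∑[]-cong (antidiagonal L) (λ (i , j) _ → sym (trans
         (∑-*ˡ (elements (pairs (square i) (three 1 1 1 j))) (+ i - + j) _)
         (cong ((+ i - + j) *_) (∑[]-pairs (square i) (three 1 1 1 j) _ _)))) ⟩
  ∑[ antidiagonal L ] (λ (i , j) → ∑[ fibre (i , j) ] (λ x → (+ i - + j) * term x))
    ≡⟨ ∑[]-dependentPairs (antidiagonal L) fibre _ ⟨
  ∑[ dependentPairs (antidiagonal L) fibre ] (λ ((i , j) , x) → (+ i - + j) * term x)
    ≡⟨ ∑[]-reindex (dependentPairs (antidiagonal L) fibre) (four L) proj₂ maps injective onto agree ⟩
  ∑[ four L ] (λ (m , v) → weight (m , v) * (m * (m * m - form 1 1 1 v)))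
    ≡⟨ weighted-harmonic L ⟩
  + 0 ∎
  where
  open ≡-Reasoning
  fibre : ((i , j) : ℕ × ℕ) → Enumeration (λ ((m , v) : ℤ⁴) → Square i m × Three 1 1 1 j v)
  fibre (i , j) = pairs (square i) (three 1 1 1 j)
  term : ℤ⁴ → ℤ
  term (m , a , b , c) = χ (cl m) * m * (odd (cl a) * even (cl b) * ρ (cl c))
  Fibred : (ℕ × ℕ) × ℤ⁴ → Set
  Fibred ((i , j) , m , v) = i ℕ.+ j ≡ L × Square i m × Three 1 1 1 j v
  maps : ∀ x → Fibred x → Four L (proj₂ x)
  maps _ (refl , p , q) = cong₂ _+_ p q
  injective : ∀ {x y} → Fibred x → Fibred y → proj₂ x ≡ proj₂ y → x ≡ y
  injective (_ , p , q) (_ , p′ , q′) refl = cong (_, _)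
    (cong₂ _,_ (ℤP.+-injective (trans (sym p) p′)) (ℤP.+-injective (trans (sym q) q′)))
  onto : ∀ {F : ℤ⁴ → ℤ} x → Four L x → (∃ λ y → Fibred y × x ≡ proj₂ y) ⊎ F x ≡ + 0
  onto (m , v) p = inj₁ (((∣ m ∣ ℕ.* ∣ m ∣ , formᴺ 1 1 1 v) , m , v)
    , (Four⇒ℕ m v p , abs-square m , form-natural 1 1 1 v) , refl)
  regroup : ∀ x o e r m s t → (s - t) * (x * m * (o * e * r)) ≡ x * o * e * r * (m * (s - t))
  regroup = solve-∀
  agree : ∀ x → Fibred x → (+ proj₁ (proj₁ x) - + proj₂ (proj₁ x)) * term (proj₂ x)
    ≡ weight (proj₂ x) * (proj₁ (proj₂ x) * (proj₁ (proj₂ x) * proj₁ (proj₂ x) - form 1 1 1 (proj₂ (proj₂ x))))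
  agree ((i , j) , m , v@(a , b , c)) (_ , p , q) = trans
    (cong₂ (λ s t → (s - t) * term (m , v)) (sym p) (sym q))
    (regroup (χ (cl m)) (odd (cl a)) (even (cl b)) (ρ (cl c)) m (m * m) (form 1 1 1 v))

opaque
  unfolding cl

  -- The values at 0 and 1 are obtained by enumeration: both series begin with 2q.
  jacobi-0 : jacobi 0 ≡ + 0
  jacobi-0 = refl

  jacobi-1 : jacobi 1 ≡ + 2
  jacobi-1 = refl

  thetas-0 : thetas 0 ≡ + 0
  thetas-0 = refl

  thetas-1 : thetas 1 ≡ + 2
  thetas-1 = refl

-- Exchanging i and j changes the sign. Subtracted from `wronskian`, this replaces `thetas j` by the
-- difference `thetas j - jacobi j`.
antisymmetric-convolution : ∀ L (f : ℕ → ℤ) → ∑[ antidiagonal L ] (λ (i , j) → (+ i - + j) * (f i * f j)) ≡ + 0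
antisymmetric-convolution L f = self-negative _ (trans
  (∑[]-involution (antidiagonal L) (λ (i , j) → j , i) (λ _ → refl) (λ (i , j) p → trans (ℕP.+-comm j i) p)
    (λ (i , j) _ → antisymmetric (+ i) (+ j) (f i) (f j)))
  (∑-*ˡ (elements (antidiagonal L)) (- + 1) F))
  where
  F : ℕ × ℕ → ℤ
  F (i , j) = (+ i - + j) * (f i * f j)
  antisymmetric : ∀ i j x y → (i - j) * (x * y) ≡ - + 1 * ((j - i) * (y * x))
  antisymmetric = solve-∀

-- For the generating functions, wronskian says that J′ Θ = J Θ′, so that J and Θ agree once their leading coefficients do.
jacobi≡thetas : ∀ k → jacobi k ≡ thetas k
jacobi≡thetas = <-rec _ step
  where
  step : ∀ k → (∀ {j} → j ℕ.< k → jacobi j ≡ thetas j) → jacobi k ≡ thetas k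
  step 0 _ = trans jacobi-0 (sym thetas-0)
  step 1 _ = trans jacobi-1 (sym thetas-1)
  -- The unknown difference at k appears with the factor (1 - k) · 2, which can be cancelled only
  -- for k ≠ 1; hence the separate value at 1.
  step k@(ℕ.suc (ℕ.suc l)) ih = sym (ℤP.i-j≡0⇒i≡j (thetas k) (jacobi k)
      (ℤP.*-cancelˡ-≡ (+ 2) _ (+ 0) (ℤP.*-cancelˡ-≡ (+ 1 - + k) _ (+ 0) isolated)))
    where
    open ≡-Reasoning
    F F₁ F₂ : ℕ × ℕ → ℤ
    F₁ (i , j) = (+ i - + j) * (jacobi i * thetas j)
    F₂ (i , j) = (+ i - + j) * (jacobi i * jacobi j)
    F (i , j) = (+ i - + j) * (jacobi i * (thetas j - jacobi j))
    -- The series start at exponent 1, so k is isolated in degree k + 1: i = 0 is killed by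
    -- `jacobi 0`, and i ≥ 2 leaves j < k, where the induction hypothesis applies.
    E = antidiagonal (ℕ.suc k)
    off : ∀ x → proj₁ x ℕ.+ proj₂ x ≡ ℕ.suc k → x ≡ (1 , k) ⊎ F x ≡ + 0
    off (0 , j) _ = inj₂ (trans (cong (λ z → (+ 0 - + j) * (z * (thetas j - jacobi j))) jacobi-0) (ℤP.*-zeroʳ (+ 0 - + j)))
    off (1 , j) p = inj₁ (cong (1 ,_) (ℕP.suc-injective p))
    off (ℕ.suc (ℕ.suc i) , j) p = inj₂ (trans
      (cong (λ z → (+ (2 ℕ.+ i) - + j) * (jacobi (2 ℕ.+ i) * z))
        (ℤP.i≡j⇒i-j≡0 (sym (ih (subst (j ℕ.<_) (ℕP.suc-injective p) (ℕ.s≤s (ℕP.m≤n+m j i)))))))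
      (trans (cong ((+ (2 ℕ.+ i) - + j) *_) (ℤP.*-zeroʳ (jacobi (2 ℕ.+ i)))) (ℤP.*-zeroʳ (+ (2 ℕ.+ i) - + j))))
    expand : ∀ s x y z → s * (x * (y - z)) ≡ s * (x * y) + - + 1 * (s * (x * z))
    expand = solve-∀
    isolated : (+ 1 - + k) * (+ 2 * (thetas k - jacobi k)) ≡ (+ 1 - + k) * + 0
    isolated = begin
      (+ 1 - + k) * (+ 2 * (thetas k - jacobi k))
        ≡⟨ cong (λ z → (+ 1 - + k) * (z * (thetas k - jacobi k))) jacobi-1 ⟨
      F (1 , k)
        ≡⟨ ∑[]-single E (1 , k) {F} refl off ⟨
      ∑[ E ] F
        ≡⟨ ∑[]-cong E (λ (i , j) _ → expand (+ i - + j) (jacobi i) (thetas j) (jacobi j)) ⟩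
      ∑[ E ] (λ x → F₁ x + - + 1 * F₂ x)
        ≡⟨ trans (∑-+ (elements E) F₁ (λ x → - + 1 * F₂ x)) (cong₂ _+_ (wronskian (ℕ.suc k))
             (trans (∑-*ˡ (elements E) (- + 1) F₂) (cong (- + 1 *_) (antisymmetric-convolution (ℕ.suc k) jacobi)))) ⟩
      + 0
        ≡⟨ ℤP.*-zeroʳ (+ 1 - + k) ⟨
      (+ 1 - + k) * + 0 ∎

-- The counting functions as sums

ℤ³ : Set
ℤ³ = ℤ × ℤ × ℤ

one : ℤ³ → ℤ
one _ = + 1

pos-sum : ∀ {X : Set} (h : X → ℕ) xs → + sum (map h xs) ≡ ∑ xs (λ x → + h x)
pos-sum h []       = refl
pos-sum h (x ∷ xs) = cong (λ z → + h x + z) (pos-sum h xs)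

module _ (g : ℤ → ℤ) (α β γ B : ℕ) (m : ℤ) where

  residual : ℤ³ → ℤ
  residual (x , y , z) = m - + α * g x - + β * g y - + γ * g z

  private
    indicator : ℤ → ℕ
    indicator r = if ⌊ r ℤ.≟ + 0 ⌋ then 1 else 0

    indicator-zero : ∀ {r} → r ≡ + 0 → indicator r ≡ 1
    indicator-zero refl = refl

  count-box : + count g (α ∷ β ∷ γ ∷ []) B m ≡ ∑[ box B ] (λ v → + indicator (residual v))
  count-box = begin
    + count g (α ∷ β ∷ γ ∷ []) B m
      ≡⟨ pos-sum _ (range B) ⟩
    ∑ (range B) (λ x → + count g (β ∷ γ ∷ []) B (m - + α * g x))
      ≡⟨ ∑-cong (range B) (λ x _ → trans (pos-sum _ (range B)) (∑-cong (range B) (λ y _ → pos-sum _ (range B)))) ⟩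
    ∑ (range B) (λ x → ∑ (range B) (λ y → ∑ (range B) (λ z → F (x , y , z))))
      ≡⟨ ∑-cong (range B) (λ x _ → ∑[]-dependentPairs (interval B) (λ _ → interval B) (λ v → F (x , v))) ⟨
    ∑ (range B) (λ x → ∑[ pairs (interval B) (interval B) ] (λ v → F (x , v)))
      ≡⟨ ∑[]-dependentPairs (interval B) (λ _ → pairs (interval B) (interval B)) F ⟨
    ∑[ box B ] F ∎
    where
    open ≡-Reasoning
    F : ℤ³ → ℤ
    F v = + indicator (residual v)

  count-solutions : ∀ {P : ℤ³ → Set} (E : Enumeration P) → (∀ v → P v → residual v ≡ + 0) →
    (∀ v → residual v ≡ + 0 → P v) → (∀ v → P v → Box B v) →
    + count g (α ∷ β ∷ γ ∷ []) B m ≡ ∑[ E ] one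
  count-solutions {P} E P⇒0 0⇒P P⊆Box = trans count-box (sym (∑[]-reindex E (box B) (λ v → v) P⊆Box (λ _ _ eq → eq)
    onto (λ v p → cong +_ (sym (indicator-zero (P⇒0 v p))))))
    where
    onto : ∀ v → Box B v → (∃ λ w → P w × v ≡ w) ⊎ + indicator (residual v) ≡ + 0
    onto v _ with residual v ℤ.≟ + 0
    ... | yes r≡0 = inj₁ (v , 0⇒P v r≡0 , refl)
    ... | no r≢0  = inj₂ refl

N-solutions : ∀ α β γ n .{{_ : ℕ.NonZero α}} .{{_ : ℕ.NonZero β}} .{{_ : ℕ.NonZero γ}} →
  + N (α ∷ β ∷ γ ∷ []) n ≡ ∑[ three α β γ n ] one
N-solutions α β γ n = count-solutions sq α β γ (ℕ.suc n) (+ n) (three α β γ n)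
  (λ v p → trans (residual-form v) (ℤP.i≡j⇒i-j≡0 (sym p)))
  (λ v r → sym (ℤP.i-j≡0⇒i≡j (+ n) _ (trans (sym (residual-form v)) r)))
  (λ v p → let x≤ , y≤ , z≤ = Three⊆Box α β γ v p in ℕP.m≤n⇒m≤1+n x≤ , ℕP.m≤n⇒m≤1+n y≤ , ℕP.m≤n⇒m≤1+n z≤)
  where
  subtract : ∀ m x y z → m - x - y - z ≡ m - (x + y + z)
  subtract = solve-∀
  residual-form : ∀ v → residual sq α β γ (ℕ.suc n) (+ n) v ≡ + n - form α β γ v
  residual-form (x , y , z) = subtract (+ n) (+ α * (x * x)) (+ β * (y * y)) (+ γ * (z * z))

triangle : ℕ → ℕ
triangle ℕ.zero    = 0
triangle (ℕ.suc k) = triangle k ℕ.+ ℕ.suc k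

triangle-double : ∀ k → + triangle k * + 2 ≡ + k * (+ 1 + + k)
triangle-double ℕ.zero    = refl
triangle-double (ℕ.suc k) = trans (split (+ triangle k) (+ k))
  (trans (cong (_+ (+ 1 + + k) * + 2) (triangle-double k)) (collect (+ k)))
  where
  split : ∀ t k → (t + (+ 1 + k)) * + 2 ≡ t * + 2 + (+ 1 + k) * + 2
  split = solve-∀
  collect : ∀ k → k * (+ 1 + k) + (+ 1 + k) * + 2 ≡ (+ 1 + k) * (+ 1 + (+ 1 + k))
  collect = solve-∀

k≤triangle : ∀ k → k ℕ.≤ triangle k
k≤triangle ℕ.zero    = ℕ.z≤n
k≤triangle (ℕ.suc k) = ℕP.m≤n+m (ℕ.suc k) (triangle k)

-- The index k is x - 1 for positive x and -x otherwise. This shows that the floor division in `tri`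
-- is exact, and the bound is attained at x = 1 and x = 2, which is why the box reaches n + 1.
triangular : ∀ x → ∃ λ k → tri x ≡ + triangle k × x * (x - + 1) ≡ + triangle k * + 2 × ∣ x ∣ ℕ.≤ ℕ.suc (triangle k)
triangular x = let k , eq , x≤ = index x in
  k , trans (cong (_/ℕ 2) (trans eq (sym (ℤP.pos-* (triangle k) 2)))) (cong +_ (ℕD.m*n/n≡m (triangle k) 2)) , eq
    , ℕP.≤-trans x≤ (ℕ.s≤s (k≤triangle k))
  where
  index : ∀ x → ∃ λ k → x * (x - + 1) ≡ + triangle k * + 2 × ∣ x ∣ ℕ.≤ ℕ.suc k
  index (+ 0)         = 0 , refl , ℕ.z≤n
  index (+ ℕ.suc k)   = k , trans (rearrange (+ k)) (sym (triangle-double k)) , ℕP.≤-refl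
    where
    rearrange : ∀ k → (+ 1 + k) * (+ 1 + k - + 1) ≡ k * (+ 1 + k)
    rearrange = solve-∀
  index -[1+ k ]      = ℕ.suc k , trans (rearrange (+ k)) (sym (triangle-double (ℕ.suc k))) , ℕP.n≤1+n (ℕ.suc k)
    where
    rearrange : ∀ k → - (+ 1 + k) * (- (+ 1 + k) - + 1) ≡ (+ 1 + k) * (+ 1 + (+ 1 + k))
    rearrange = solve-∀

tri-double : ∀ x → x * (x - + 1) ≡ tri x * + 2
tri-double x = let k , eq , eq′ , _ = triangular x in trans eq′ (cong (_* + 2) (sym eq))

Triangular : ℕ → ℤ³ → Set
Triangular n (x , y , z) = + 1 * tri x + + 1 * tri y + + 8 * tri z ≡ + n

Triangular⊆Box : ∀ {n} v → Triangular n v → Box (ℕ.suc n) v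
Triangular⊆Box {n} (x , y , z) p with triangular x | triangular y | triangular z
... | i , ti , _ , x≤ | j , tj , _ , y≤ | k , tk , _ , z≤ =
    ℕP.≤-trans x≤ (ℕ.s≤s (ℕP.≤-trans (ℕP.≤-trans (ℕP.m≤m+n _ _) (ℕP.m≤m+n _ (8 ℕ.* triangle k))) total≤))
  , ℕP.≤-trans y≤ (ℕ.s≤s (ℕP.≤-trans (ℕP.≤-trans (ℕP.m≤n+m _ (triangle i)) (ℕP.m≤m+n _ (8 ℕ.* triangle k))) total≤))
  , ℕP.≤-trans z≤ (ℕ.s≤s (ℕP.≤-trans (ℕP.≤-trans (ℕP.m≤n*m _ 8) (ℕP.m≤n+m _ (triangle i ℕ.+ triangle j))) total≤))
  where
  total≤ : triangle i ℕ.+ triangle j ℕ.+ 8 ℕ.* triangle k ℕ.≤ n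
  total≤ = ℕP.≤-reflexive (ℤP.+-injective (trans
    (cong₂ _+_ (cong₂ _+_ (trans (sym ti) (sym (ℤP.*-identityˡ (tri x)))) (trans (sym tj) (sym (ℤP.*-identityˡ (tri y)))))
      (trans (ℤP.pos-* 8 (triangle k)) (cong (+ 8 *_) (sym tk))))
    p))

triangulars : ∀ n → Enumeration (Triangular n)
triangulars n = subset (λ (x , y , z) → + 1 * tri x + + 1 * tri y + + 8 * tri z ℤ.≟ + n) Triangular⊆Box (box (ℕ.suc n))

t-solutions : ∀ n → + t (1 ∷ 1 ∷ 8 ∷ []) n ≡ ∑[ triangulars n ] one
t-solutions n = count-solutions tri 1 1 8 (ℕ.suc n) (+ n) (triangulars n)
  (λ v p → trans (residual-form v) (ℤP.i≡j⇒i-j≡0 (sym p)))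
  (λ v r → sym (ℤP.i-j≡0⇒i≡j (+ n) _ (trans (sym (residual-form v)) r)))
  Triangular⊆Box
  where
  subtract : ∀ m x y z → m - x - y - z ≡ m - (x + y + z)
  subtract = solve-∀
  residual-form : ∀ (v@(x , y , z) : ℤ³) → residual tri 1 1 8 (ℕ.suc n) (+ n) v ≡ + n - (+ 1 * tri x + + 1 * tri y + + 8 * tri z)
  residual-form (x , y , z) = subtract (+ n) (+ 1 * tri x) (+ 1 * tri y) (+ 8 * tri z)

-- Reduction to sums of three squares

square₄ : ℤ₄ → ℤ₄
square₄ r = r ⊗ r

form₄ : ℤ₄ → ℤ₄ → ℤ₄ → ℤ₄
form₄ x y z = square₄ x ⊕ square₄ y ⊕ square₄ z

cl-square : ∀ x → cl (+ 1 * (x * x)) ≡ square₄ (cl x)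
cl-square x = trans (cong cl (ℤP.*-identityˡ (x * x))) (cl-* x x)

cl-form : ∀ x y z → cl (form 1 1 1 (x , y , z)) ≡ form₄ (cl x) (cl y) (cl z)
cl-form x y z = trans (cl-+ (+ 1 * (x * x) + + 1 * (y * y)) (+ 1 * (z * z))) (cong₂ _⊕_
  (trans (cl-+ (+ 1 * (x * x)) (+ 1 * (y * y))) (cong₂ _⊕_ (cl-square x) (cl-square y))) (cl-square z))

by-cases₃ : {f g : ℤ₄ → ℤ₄ → ℤ₄ → ℤ} →
  {True (FinP.all? λ a → FinP.all? λ b → FinP.all? λ c → (form₄ a b c Fin.≟ 1F) →-dec (f a b c ℤ.≟ g a b c))} →
  ∀ a b c → form₄ a b c ≡ 1F → f a b c ≡ g a b c
by-cases₃ {_} {_} {t} = toWitness t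

-- Squares are 0 or 1 modulo 4, so a sum of three with residue 1 has exactly one odd term; the next
-- three identities rest on the same fact.
one-odd₄ : ∀ a b c → form₄ a b c ≡ 1F → + 1 ≡ odd a + odd b + odd c
one-odd₄ = by-cases₃

even-third₄ : ∀ a b c → form₄ a b c ≡ 1F → even c ≡ odd a + odd b
even-third₄ = by-cases₃

ρ-third₄ : ∀ a b c → form₄ a b c ≡ 1F → ρ c ≡ odd a * even b * ρ c + odd b * even a * ρ c
ρ-third₄ = by-cases₃

odd-sum₄ : ∀ a b c → form₄ a b c ≡ 1F → even c * odd (a ⊕ b ⊕ 1F) ≡ + 0
odd-sum₄ = by-cases₃

-- This is where the sign (-1)^(c/2) arises: among even c, those with c ≡ 2 count +1 and those with
-- c ≡ 0 count -1.
two-even-ρ : ∀ c → + 2 * two c - even c ≡ - + 1 * ρ c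
two-even-ρ 0F = refl
two-even-ρ 1F = refl
two-even-ρ 2F = refl
two-even-ρ 3F = refl

even-sum₄ : ∀ a b → square₄ a ⊕ square₄ b ≡ 2F → odd (a ⊕ b) ≡ + 0
even-sum₄ = toWitness {a? = FinP.all? λ a → FinP.all? λ b → (square₄ a ⊕ square₄ b Fin.≟ 2F) →-dec (odd (a ⊕ b) ℤ.≟ + 0)} _

odd-double+1 : ∀ r → odd (r ⊕ r ⊕ 1F) ≡ + 1
odd-double+1 0F = refl
odd-double+1 1F = refl
odd-double+1 2F = refl
odd-double+1 3F = refl

even-double : ∀ r → even (r ⊕ r) ≡ + 1
even-double 0F = refl
even-double 1F = refl
even-double 2F = refl
even-double 3F = refl

even⊎odd : ∀ r → even r ≡ + 0 ⊎ odd r ≡ + 0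
even⊎odd 0F = inj₂ refl
even⊎odd 1F = inj₁ refl
even⊎odd 2F = inj₂ refl
even⊎odd 3F = inj₁ refl

cl-double+1 : ∀ k → cl (k + k + + 1) ≡ cl k ⊕ cl k ⊕ 1F
cl-double+1 k = trans (cl-+ (k + k) (+ 1)) (cong₂ _⊕_ (cl-+ k k) (cl-const 1))

halve : ∀ x → odd (cl x) ≡ + 0 → ∃ λ k → x ≡ k + k
halve x even-x with even-or-odd x
... | k , inj₁ eq   = k , eq
... | k , inj₂ refl = contradiction (trans (sym even-x) (trans (cong odd (cl-double+1 k)) (odd-double+1 (cl k)))) λ ()

double-injective : ∀ {k l} → k + k ≡ l + l → k ≡ l
double-injective {k} {l} eq = ℤP.*-cancelʳ-≡ k l (+ 2) (trans (double k) (trans eq (sym (double l))))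
  where
  double : ∀ k → k * + 2 ≡ k + k
  double = solve-∀

pos-4n+5 : ∀ n → + (4 ℕ.* n ℕ.+ 5) ≡ + 4 * + n + + 5
pos-4n+5 n = cong (_+ + 5) (ℤP.pos-* 4 n)

cl-4n+5 : ∀ n → cl (+ (4 ℕ.* n ℕ.+ 5)) ≡ 1F
cl-4n+5 n = cl-unique 5 (+ n) (trans (pos-4n+5 n) (reorder (+ n)))
  where
  reorder : ∀ n → + 4 * n + + 5 ≡ + 5 + n * + 4
  reorder = solve-∀

module _ (n : ℕ) where

  private
    M : ℕ
    M = 4 ℕ.* n ℕ.+ 5

    S : (ℤ³ → ℤ) → ℤ
    S F = ∑[ three 1 1 1 M ] F

    +M : + M ≡ + 4 * + n + + 5
    +M = pos-4n+5 n

    form₄≡1 : ∀ x y z → Three 1 1 1 M (x , y , z) → form₄ (cl x) (cl y) (cl z) ≡ 1F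
    form₄≡1 x y z p = trans (sym (cl-form x y z)) (trans (cong cl p) (cl-4n+5 n))

  -- Completing the squares gives the constant 5 = 1 + 4. The image is exactly c ≡ 2 modulo 4,
  -- because the residue of M then forces a + b to be odd.
  t-residues : + t (1 ∷ 1 ∷ 8 ∷ []) n ≡ S (λ (a , b , c) → two (cl c))
  t-residues = trans (t-solutions n) (∑[]-reindex (triangulars n) (three 1 1 1 M) f maps (λ _ _ → injective) onto
    (λ (x , y , z) _ → sym (cong two (cl-third z))))
    where
    f : ℤ³ → ℤ³
    f (x , y , z) = x + y - + 1 , x - y , z * + 4 - + 2
    cl-third : ∀ z → cl (z * + 4 - + 2) ≡ 2F
    cl-third z = cl-unique 2 (z - + 1) (shift z)
      where
      shift : ∀ z → z * + 4 - + 2 ≡ + 2 + (z - + 1) * + 4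
      shift = solve-∀
    complete-squares : ∀ x y z →
      + 1 * ((x + y - + 1) * (x + y - + 1)) + + 1 * ((x - y) * (x - y)) + + 1 * ((z * + 4 - + 2) * (z * + 4 - + 2))
      ≡ + 2 * (x * (x - + 1)) + + 2 * (y * (y - + 1)) + + 16 * (z * (z - + 1)) + + 5
    complete-squares = solve-∀
    factor : ∀ r s t → + 2 * (r * + 2) + + 2 * (s * + 2) + + 16 * (t * + 2) + + 5 ≡ + 4 * (+ 1 * r + + 1 * s + + 8 * t) + + 5
    factor = solve-∀
    form-f : ∀ x y z → form 1 1 1 (f (x , y , z)) ≡ + 4 * (+ 1 * tri x + + 1 * tri y + + 8 * tri z) + + 5
    form-f x y z = begin
      form 1 1 1 (f (x , y , z))
        ≡⟨ complete-squares x y z ⟩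
      + 2 * (x * (x - + 1)) + + 2 * (y * (y - + 1)) + + 16 * (z * (z - + 1)) + + 5
        ≡⟨ cong (_+ + 5) (cong₂ _+_ (cong₂ _+_ (cong (+ 2 *_) (tri-double x)) (cong (+ 2 *_) (tri-double y))) (cong (+ 16 *_) (tri-double z))) ⟩
      + 2 * (tri x * + 2) + + 2 * (tri y * + 2) + + 16 * (tri z * + 2) + + 5
        ≡⟨ factor (tri x) (tri y) (tri z) ⟩
      + 4 * (+ 1 * tri x + + 1 * tri y + + 8 * tri z) + + 5 ∎
      where open ≡-Reasoning
    maps : ∀ v → Triangular n v → Three 1 1 1 M (f v)
    maps (x , y , z) p = trans (form-f x y z) (trans (cong (λ s → + 4 * s + + 5) p) (sym +M))
    maps⁻ : ∀ v → Three 1 1 1 M (f v) → Triangular n v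
    maps⁻ (x , y , z) p = ℤP.*-cancelˡ-≡ (+ 4) _ (+ n)
      (∙-cancelʳ (+ 5) (+ 4 * (+ 1 * tri x + + 1 * tri y + + 8 * tri z)) (+ 4 * + n) (trans (sym (form-f x y z)) (trans p +M)))
    injective : ∀ {v w} → f v ≡ f w → v ≡ w
    injective {x , y , z} {x′ , y′ , z′} eq = cong₂ _,_ x≡x′ (cong₂ _,_ y≡y′ z≡z′)
      where
      recover-x : ∀ x y → x + y - + 1 + (x - y) + + 1 ≡ x + x
      recover-x = solve-∀
      recover-y : ∀ x y → x - (x - y) ≡ y
      recover-y = solve-∀
      x≡x′ : x ≡ x′
      x≡x′ = double-injective (trans (sym (recover-x x y))
        (trans (cong₂ (λ a b → a + b + + 1) (cong proj₁ eq) (cong (proj₁ ∘ proj₂) eq)) (recover-x x′ y′)))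
      y≡y′ : y ≡ y′
      y≡y′ = trans (sym (recover-y x y)) (trans (cong₂ _-_ x≡x′ (cong (proj₁ ∘ proj₂) eq)) (recover-y x′ y′))
      z≡z′ : z ≡ z′
      z≡z′ = ℤP.*-cancelʳ-≡ z z′ (+ 4) (∙-cancelʳ (- + 2) (z * + 4) (z′ * + 4) (cong (proj₂ ∘ proj₂) eq))
    two-cases : ∀ r → two r ≡ + 0 ⊎ r ≡ 2F
    two-cases 0F = inj₁ refl
    two-cases 1F = inj₁ refl
    two-cases 2F = inj₂ refl
    two-cases 3F = inj₁ refl
    onto : ∀ v → Three 1 1 1 M v → (∃ λ w → Triangular n w × v ≡ f w) ⊎ two (cl (proj₂ (proj₂ v))) ≡ + 0
    onto v@(a , b , c) p with two-cases (cl c)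
    ... | inj₁ z    = inj₂ z
    ... | inj₂ cl-c = inj₁ (w , maps⁻ w (subst (Three 1 1 1 M) v≡fw p) , v≡fw)
      where
      even-a+b+1 : odd (cl (a + b + + 1)) ≡ + 0
      even-a+b+1 = begin
        odd (cl (a + b + + 1))                    ≡⟨ cong odd (trans (cl-+ (a + b) (+ 1)) (cong₂ _⊕_ (cl-+ a b) (cl-const 1))) ⟩
        odd (cl a ⊕ cl b ⊕ 1F)                    ≡⟨ ℤP.*-identityˡ _ ⟨
        even 2F * odd (cl a ⊕ cl b ⊕ 1F)          ≡⟨ cong (λ r → even r * odd (cl a ⊕ cl b ⊕ 1F)) cl-c ⟨
        even (cl c) * odd (cl a ⊕ cl b ⊕ 1F)      ≡⟨ odd-sum₄ (cl a) (cl b) (cl c) (form₄≡1 a b c p) ⟩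
        + 0                                       ∎
        where open ≡-Reasoning
      k = proj₁ (halve (a + b + + 1) even-a+b+1)
      w : ℤ³
      -- Inverse of `f`: x = (a + b + 1) / 2, y = x - b, and c = 4q + 2 = 4 (q + 1) - 2.
      w = k , k - b , quot c + + 1
      first : ∀ a b → a ≡ a + b + + 1 - b - + 1
      first = solve-∀
      regroup : ∀ k b → k + k - b - + 1 ≡ k + (k - b) - + 1
      regroup = solve-∀
      second : ∀ k b → b ≡ k - (k - b)
      second = solve-∀
      third : ∀ q → + 2 + q * + 4 ≡ (q + + 1) * + 4 - + 2
      third = solve-∀
      v≡fw : v ≡ f w
      v≡fw = cong₂ _,_
        (trans (first a b) (trans (cong (λ s → s - b - + 1) (proj₂ (halve (a + b + + 1) even-a+b+1))) (regroup k b)))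
        (cong₂ _,_ (second k b)
          (trans (cl-quot c) (trans (cong (λ r → + toℕ r + quot c * + 4) cl-c) (third (quot c)))))

  -- Both sides count a² + b² + 4z² = M: the map `f` doubles this form, and c = 2z runs through the
  -- even values. For surjectivity of `f`, x² + y² ≡ 2 modulo 4 makes x + y even.
  N-residues : + N (1 ∷ 1 ∷ 8 ∷ []) (8 ℕ.* n ℕ.+ 10) ≡ S (λ (a , b , c) → even (cl c))
  N-residues = begin
    + N (1 ∷ 1 ∷ 8 ∷ []) (8 ℕ.* n ℕ.+ 10)       ≡⟨ N-solutions 1 1 8 (8 ℕ.* n ℕ.+ 10) ⟩
    ∑[ three 1 1 8 (8 ℕ.* n ℕ.+ 10) ] one       ≡⟨ ∑[]-reindex (three 1 1 4 M) (three 1 1 8 (8 ℕ.* n ℕ.+ 10)) f f-maps (λ _ _ → f-injective) (f-onto one) (λ _ _ → refl) ⟨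
    ∑[ three 1 1 4 M ] one                      ≡⟨ ∑[]-reindex (three 1 1 4 M) (three 1 1 1 M) h h-maps (λ _ _ → h-injective) h-onto
                                                     (λ (a , b , z) _ → sym (trans (cong even (cl-+ z z)) (even-double (cl z)))) ⟩
    S (λ (a , b , c) → even (cl c))             ∎
    where
    open ≡-Reasoning
    f h : ℤ³ → ℤ³
    f (a , b , z) = a + b , a - b , z
    h (a , b , z) = a , b , z + z
    +8n+10 : + (8 ℕ.* n ℕ.+ 10) ≡ + 2 * + M
    +8n+10 = trans (cong (_+ + 10) (ℤP.pos-* 8 n)) (trans (factor (+ n)) (cong (+ 2 *_) (sym +M)))
      where
      factor : ∀ n → + 8 * n + + 10 ≡ + 2 * (+ 4 * n + + 5)
      factor = solve-∀
    form-f : ∀ a b z → + 1 * ((a + b) * (a + b)) + + 1 * ((a - b) * (a - b)) + + 8 * (z * z)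
      ≡ + 2 * (+ 1 * (a * a) + + 1 * (b * b) + + 4 * (z * z))
    form-f = solve-∀
    f-maps : ∀ v → Three 1 1 4 M v → Three 1 1 8 (8 ℕ.* n ℕ.+ 10) (f v)
    f-maps (a , b , z) p = trans (form-f a b z) (trans (cong (+ 2 *_) p) (sym +8n+10))
    f-injective : ∀ {v w} → f v ≡ f w → v ≡ w
    f-injective {a , b , z} {a′ , b′ , z′} eq = cong₂ _,_ a≡a′ (cong₂ _,_ b≡b′ (cong (proj₂ ∘ proj₂) eq))
      where
      recover-a : ∀ a b → a + b + (a - b) ≡ a + a
      recover-a = solve-∀
      recover-b : ∀ a b → a + b - a ≡ b
      recover-b = solve-∀
      a≡a′ : a ≡ a′
      a≡a′ = double-injective (trans (sym (recover-a a b)) (trans (cong₂ _+_ (cong proj₁ eq) (cong (proj₁ ∘ proj₂) eq)) (recover-a a′ b′)))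
      b≡b′ : b ≡ b′
      b≡b′ = trans (sym (recover-b a b)) (trans (cong₂ _-_ (cong proj₁ eq) a≡a′) (recover-b a′ b′))
    f-onto : ∀ (G : ℤ³ → ℤ) v → Three 1 1 8 (8 ℕ.* n ℕ.+ 10) v → (∃ λ w → Three 1 1 4 M w × v ≡ f w) ⊎ G v ≡ + 0
    f-onto _ v@(x , y , z) p = inj₁ (w , ℤP.*-cancelˡ-≡ (+ 2) _ (+ M)
        (trans (sym (form-f k (x - k) z)) (trans (subst (Three 1 1 8 (8 ℕ.* n ℕ.+ 10)) v≡fw p) +8n+10)) , v≡fw)
      where
      regroup : ∀ x y z → + 1 * (x * x) + + 1 * (y * y) + + 8 * (z * z) ≡ x * x + y * y + (+ 2 * (z * z)) * + 4
      regroup = solve-∀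
      drop-8 : cl (form 1 1 8 v) ≡ square₄ (cl x) ⊕ square₄ (cl y)
      drop-8 = begin
        cl (form 1 1 8 v)                                     ≡⟨ cong cl (regroup x y z) ⟩
        cl (x * x + y * y + (+ 2 * (z * z)) * + 4)            ≡⟨ cl-shift (x * x + y * y) (+ 2 * (z * z)) ⟩
        cl (x * x + y * y)                                    ≡⟨ trans (cl-+ (x * x) (y * y)) (cong₂ _⊕_ (cl-* x x) (cl-* y y)) ⟩
        square₄ (cl x) ⊕ square₄ (cl y)                       ∎
      residue : square₄ (cl x) ⊕ square₄ (cl y) ≡ 2F
      residue = trans (sym drop-8) (trans (cong cl (trans p +8n+10))
        (trans (cl-* (+ 2) (+ M)) (cong₂ _⊗_ (cl-const 2) (cl-4n+5 n))))
      half = halve (x + y) (trans (cong odd (cl-+ x y)) (even-sum₄ (cl x) (cl y) residue))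
      k = proj₁ half
      w : ℤ³
      w = k , x - k , z
      first : ∀ x k → x ≡ k + (x - k)
      first = solve-∀
      second : ∀ x y → y ≡ x + y - x
      second = solve-∀
      second′ : ∀ x k → k + k - x ≡ k - (x - k)
      second′ = solve-∀
      v≡fw : v ≡ f w
      v≡fw = cong₂ _,_ (first x k) (cong (_, z) (trans (second x y) (trans (cong (_- x) (proj₂ half)) (second′ x k))))
    form-h : ∀ a b z → + 1 * (a * a) + + 1 * (b * b) + + 1 * ((z + z) * (z + z))
      ≡ + 1 * (a * a) + + 1 * (b * b) + + 4 * (z * z)
    form-h = solve-∀
    h-maps : ∀ v → Three 1 1 4 M v → Three 1 1 1 M (h v)
    h-maps (a , b , z) p = trans (form-h a b z) p
    h-injective : ∀ {v w} → h v ≡ h w → v ≡ w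
    h-injective eq = cong₂ _,_ (cong proj₁ eq)
      (cong₂ _,_ (cong (proj₁ ∘ proj₂) eq) (double-injective (cong (proj₂ ∘ proj₂) eq)))
    h-onto : ∀ v → Three 1 1 1 M v → (∃ λ w → Three 1 1 4 M w × v ≡ h w) ⊎ even (cl (proj₂ (proj₂ v))) ≡ + 0
    h-onto (a , b , c) p with even⊎odd (cl c)
    ... | inj₁ z = inj₂ z
    ... | inj₂ z with halve c z
    ... | k , refl = inj₁ ((a , b , k) , trans (sym (form-h a b k)) p , refl)

  private
    -- The common value of N/2 and r₃/3: exactly one coordinate of a solution is odd and each
    -- position is equally frequent, so the third is even in 2O of the 3O solutions.
    O : ℤ
    O = S (λ (a , b , c) → odd (cl a))

    swap-form : ∀ a b c → + 1 * (b * b) + + 1 * (a * a) + + 1 * (c * c) ≡ + 1 * (a * a) + + 1 * (b * b) + + 1 * (c * c)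
    swap-form = solve-∀

    swap₁₂ : ∀ F → S F ≡ S (λ (a , b , c) → F (b , a , c))
    swap₁₂ F = ∑[]-involution (three 1 1 1 M) (λ (a , b , c) → b , a , c) (λ _ → refl)
      (λ (a , b , c) p → trans (swap-form a b c) p) (λ _ _ → refl)

    reverse-form : ∀ a b c → + 1 * (c * c) + + 1 * (b * b) + + 1 * (a * a) ≡ + 1 * (a * a) + + 1 * (b * b) + + 1 * (c * c)
    reverse-form = solve-∀

    swap₁₃ : ∀ F → S F ≡ S (λ (a , b , c) → F (c , b , a))
    swap₁₃ F = ∑[]-involution (three 1 1 1 M) (λ (a , b , c) → c , b , a) (λ _ → refl)
      (λ (a , b , c) p → trans (reverse-form a b c) p) (λ _ _ → refl)

    oddᵃ oddᵇ oddᶜ : ℤ³ → ℤ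
    oddᵃ (a , b , c) = odd (cl a)
    oddᵇ (a , b , c) = odd (cl b)
    oddᶜ (a , b , c) = odd (cl c)

    even-count : S (λ (a , b , c) → even (cl c)) ≡ O + O
    even-count = begin
      S (λ (a , b , c) → even (cl c))      ≡⟨ ∑[]-cong (three 1 1 1 M) (λ (a , b , c) p → even-third₄ (cl a) (cl b) (cl c) (form₄≡1 a b c p)) ⟩
      S (λ v → oddᵃ v + oddᵇ v)            ≡⟨ ∑-+ (elements (three 1 1 1 M)) oddᵃ oddᵇ ⟩
      S oddᵃ + S oddᵇ                      ≡⟨ cong (λ z → O + z) (swap₁₂ oddᵇ) ⟩
      O + O                                ∎
      where open ≡-Reasoning

  r₃-residues : + r₃ M ≡ O + O + O
  r₃-residues = begin
    + r₃ M                               ≡⟨ N-solutions 1 1 1 M ⟩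
    S one                                ≡⟨ ∑[]-cong (three 1 1 1 M) (λ (a , b , c) p → one-odd₄ (cl a) (cl b) (cl c) (form₄≡1 a b c p)) ⟩
    S (λ v → oddᵃ v + oddᵇ v + oddᶜ v)   ≡⟨ trans (∑-+ (elements (three 1 1 1 M)) (λ v → oddᵃ v + oddᵇ v) oddᶜ) (cong (_+ S oddᶜ) (∑-+ (elements (three 1 1 1 M)) oddᵃ oddᵇ)) ⟩
    S oddᵃ + S oddᵇ + S oddᶜ             ≡⟨ cong₂ (λ y z → O + y + z) (swap₁₂ oddᵇ) (swap₁₃ oddᶜ) ⟩
    O + O + O                            ∎
    where open ≡-Reasoning

  N-odd : + N (1 ∷ 1 ∷ 8 ∷ []) (8 ℕ.* n ℕ.+ 10) ≡ O + O
  N-odd = trans N-residues even-count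

  -- The summand reduces to -ρ(c). For even c exactly one of a, b is odd, and the two possibilities
  -- contribute `thetas M` each.
  2t-N : + 2 * + t (1 ∷ 1 ∷ 8 ∷ []) n - + N (1 ∷ 1 ∷ 8 ∷ []) (8 ℕ.* n ℕ.+ 10) ≡ + 2 * - thetas M
  2t-N = begin
    + 2 * + t (1 ∷ 1 ∷ 8 ∷ []) n - + N (1 ∷ 1 ∷ 8 ∷ []) (8 ℕ.* n ℕ.+ 10)
      ≡⟨ cong₂ (λ y z → + 2 * y - z) t-residues N-residues ⟩
    + 2 * S twoᶜ - S evenᶜ
      ≡⟨ linear (S twoᶜ) (S evenᶜ) ⟩
    + 2 * S twoᶜ + - + 1 * S evenᶜ
      ≡⟨ cong₂ _+_ (∑-*ˡ es (+ 2) twoᶜ) (∑-*ˡ es (- + 1) evenᶜ) ⟨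
    S (λ v → + 2 * twoᶜ v) + S (λ v → - + 1 * evenᶜ v)
      ≡⟨ ∑-+ es (λ v → + 2 * twoᶜ v) (λ v → - + 1 * evenᶜ v) ⟨
    S (λ v → + 2 * twoᶜ v + - + 1 * evenᶜ v)
      ≡⟨ ∑[]-cong (three 1 1 1 M) (λ (a , b , c) p → trans (sym (linear (two (cl c)) (even (cl c)))) (trans (two-even-ρ (cl c))
           (cong (- + 1 *_) (ρ-third₄ (cl a) (cl b) (cl c) (form₄≡1 a b c p))))) ⟩
    S (λ v → - + 1 * (θ v + θ′ v))
      ≡⟨ trans (∑-*ˡ es (- + 1) (λ v → θ v + θ′ v)) (cong (- + 1 *_) (∑-+ es θ θ′)) ⟩
    - + 1 * (S θ + S θ′)
      ≡⟨ cong (λ z → - + 1 * (S θ + z)) (swap₁₂ θ′) ⟩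
    - + 1 * (S θ + S θ)
      ≡⟨ collect (S θ) ⟩
    + 2 * - thetas M ∎
    where
    open ≡-Reasoning
    es = elements (three 1 1 1 M)
    twoᶜ evenᶜ θ θ′ : ℤ³ → ℤ
    twoᶜ  (a , b , c) = two (cl c)
    evenᶜ (a , b , c) = even (cl c)
    θ     (a , b , c) = odd (cl a) * even (cl b) * ρ (cl c)
    θ′    (a , b , c) = odd (cl b) * even (cl a) * ρ (cl c)
    linear : ∀ y z → + 2 * y - z ≡ + 2 * y + - + 1 * z
    linear = solve-∀
    collect : ∀ z → - + 1 * (z + z) ≡ + 2 * - z
    collect = solve-∀

  3t-r₃ : + 3 * + t (1 ∷ 1 ∷ 8 ∷ []) n - + r₃ M ≡ + 3 * - thetas M
  3t-r₃ = ℤP.*-cancelˡ-≡ (+ 2) _ _ (begin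
    + 2 * (+ 3 * T - + r₃ M)          ≡⟨ cong (λ z → + 2 * (+ 3 * T - z)) r₃-residues ⟩
    + 2 * (+ 3 * T - (O + O + O))     ≡⟨ regroup T O ⟩
    + 3 * (+ 2 * T - (O + O))         ≡⟨ cong (λ z → + 3 * (+ 2 * T - z)) N-odd ⟨
    + 3 * (+ 2 * T - + N (1 ∷ 1 ∷ 8 ∷ []) (8 ℕ.* n ℕ.+ 10))  ≡⟨ cong (+ 3 *_) 2t-N ⟩
    + 3 * (+ 2 * - thetas M)          ≡⟨ commute (- thetas M) ⟩
    + 2 * (+ 3 * - thetas M)          ∎)
    where
    open ≡-Reasoning
    T = + t (1 ∷ 1 ∷ 8 ∷ []) n
    regroup : ∀ t o → + 2 * (+ 3 * t - (o + o + o)) ≡ + 3 * (+ 2 * t - (o + o))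
    regroup = solve-∀
    commute : ∀ v → + 3 * (+ 2 * v) ≡ + 2 * (+ 3 * v)
    commute = solve-∀

-- Evaluation of the Jacobi series

χ-neg : ∀ r → χ (3F ⊗ r) ≡ - χ r
χ-neg 0F = refl
χ-neg 1F = refl
χ-neg 2F = refl
χ-neg 3F = refl

χ-2 : ∀ r → χ (2F ⊕ r) ≡ - χ r
χ-2 0F = refl
χ-2 1F = refl
χ-2 2F = refl
χ-2 3F = refl

odd-2 : ∀ r → odd (2F ⊕ r) ≡ odd r
odd-2 0F = refl
odd-2 1F = refl
odd-2 2F = refl
odd-2 3F = refl

odd-square : ∀ r → square₄ r ≡ 1F → odd r ≡ + 1
odd-square 1F _ = refl
odd-square 3F _ = refl

-- Induction in steps of two, each of which flips both signs. The minus sign cancels the one of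
-- `- thetas` in `rhs`.
χ-power : ∀ m → odd (cl (+ m)) ≡ + 1 → χ (cl (+ m)) ≡ - (-[1+ 0 ] ℤ.^ (ℕ.suc m ℕ./ 2))
χ-power 0 odd-m = contradiction (trans (sym (cong odd (cl-const 0))) odd-m) λ ()
χ-power 1 _     = cong χ (cl-const 1)
χ-power (ℕ.suc (ℕ.suc m)) odd-m = begin
  χ (cl (+ 2 + + m))                              ≡⟨ cong χ cl-2+m ⟩
  χ (2F ⊕ cl (+ m))                               ≡⟨ χ-2 (cl (+ m)) ⟩
  - χ (cl (+ m))                                  ≡⟨ cong -_ (χ-power m (trans (sym (trans (cong odd cl-2+m) (odd-2 (cl (+ m))))) odd-m)) ⟩
  - - (-[1+ 0 ] ℤ.^ (ℕ.suc m ℕ./ 2))              ≡⟨ cong -_ (ℤP.-1*i≡-i _) ⟨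
  - (-[1+ 0 ] ℤ.^ ℕ.suc (ℕ.suc m ℕ./ 2))          ≡⟨ cong (λ e → - (-[1+ 0 ] ℤ.^ e)) (ℕD.m/n≡1+[m∸n]/n {3 ℕ.+ m} {2} (ℕ.s≤s (ℕ.s≤s ℕ.z≤n))) ⟨
  - (-[1+ 0 ] ℤ.^ ((3 ℕ.+ m) ℕ./ 2))              ∎
  where
  open ≡-Reasoning
  cl-2+m : cl (+ 2 + + m) ≡ 2F ⊕ cl (+ m)
  cl-2+m = trans (cl-+ (+ 2) (+ m)) (cong (_⊕ cl (+ m)) (cl-const 2))

±_ : ∀ m → Enumeration (λ x → x ≡ + ℕ.suc m ⊎ x ≡ - + ℕ.suc m)
± m = record
  { elements = + ℕ.suc m ∷ - + ℕ.suc m ∷ []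
  ; unique   = ((λ ()) ∷ []) ∷ [] ∷ []
  ; sound    = λ { (here eq) → inj₁ eq ; (there (here eq)) → inj₂ eq }
  ; complete = λ { (inj₁ eq) → here eq ; (inj₂ eq) → there (here eq) }
  }

jacobi-square : ∀ m → jacobi (ℕ.suc m ℕ.* ℕ.suc m) ≡ + 2 * (χ (cl (+ ℕ.suc m)) * + ℕ.suc m)
jacobi-square m-1 = begin
  jacobi (ℕ.suc m-1 ℕ.* ℕ.suc m-1)                  ≡⟨ ∑[]-reindex (± m-1) (square _) (λ x → x) maps (λ _ _ eq → eq) onto (λ _ _ → refl) ⟨
  ∑[ ± m-1 ] (λ x → χ (cl x) * x)                   ≡⟨ cong (λ z → χ (cl m) * m + (z * - m + + 0)) (trans (cong χ (cl-neg m)) (χ-neg (cl m))) ⟩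
  -- `χ` is odd, so the roots m and -m contribute equally.
  χ (cl m) * m + (- χ (cl m) * - m + + 0)           ≡⟨ collect (χ (cl m)) m ⟩
  + 2 * (χ (cl m) * m)                              ∎
  where
  open ≡-Reasoning
  m : ℤ
  m = + ℕ.suc m-1
  F : ℤ → ℤ
  F x = χ (cl x) * x
  collect : ∀ s m → s * m + (- s * - m + + 0) ≡ + 2 * (s * m)
  collect = solve-∀
  maps : ∀ x → x ≡ m ⊎ x ≡ - m → Square (ℕ.suc m-1 ℕ.* ℕ.suc m-1) x
  maps _ (inj₁ refl) = refl
  maps _ (inj₂ refl) = refl
  difference-of-squares : ∀ x m → (x - m) * (x - - m) ≡ x * x - m * m
  difference-of-squares = solve-∀
  onto : ∀ x → Square (ℕ.suc m-1 ℕ.* ℕ.suc m-1) x → (∃ λ y → (y ≡ m ⊎ y ≡ - m) × x ≡ y) ⊎ F x ≡ + 0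
  onto x p with ℤP.i*j≡0⇒i≡0∨j≡0 (x - m) (trans (difference-of-squares x m) (ℤP.i≡j⇒i-j≡0 p))
  ... | inj₁ eq = inj₁ (x , inj₁ (ℤP.i-j≡0⇒i≡j x m eq) , refl)
  ... | inj₂ eq = inj₁ (x , inj₂ (ℤP.i-j≡0⇒i≡j x (- m) eq) , refl)

jacobi-nonsquare : ∀ i → (∀ m → i ≢ m ℕ.* m) → jacobi i ≡ + 0
jacobi-nonsquare i ¬sq = ∑[]-zero (square i)
  (λ x p → contradiction (ℤP.+-injective (trans (sym p) (abs-square x))) (¬sq ∣ x ∣))

-- The finite list of integer roots decides: its head is a root, and an empty list excludes all.
square? : ∀ i → (∃ λ m → i ≡ m ℕ.* m) ⊎ (∀ m → i ≢ m ℕ.* m)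
square? i with elements (square i) in eq
... | []    = inj₂ (λ m p → contradiction (subst (+ m ∈_) eq (complete (square i) (trans (sym (ℤP.pos-* m m)) (cong +_ (sym p))))) λ ())
... | x ∷ _ = inj₁ (∣ x ∣ , ℤP.+-injective (trans (sym (sound (square i) (subst (x ∈_) (sym eq) (here refl)))) (abs-square x)))

rhs : ∀ n → RHS n (- thetas (4 ℕ.* n ℕ.+ 5))
rhs n with square? (4 ℕ.* n ℕ.+ 5)
... | inj₂ ¬sq = inj₂ ((λ (m , _ , p) → ¬sq m p)
    , cong -_ (trans (sym (jacobi≡thetas M)) (jacobi-nonsquare M ¬sq)))
  where
  M = 4 ℕ.* n ℕ.+ 5
... | inj₁ (0 , p) = contradiction (trans (ℕP.+-comm 5 (4 ℕ.* n)) p) λ ()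
... | inj₁ (m@(ℕ.suc m-1) , p) = inj₁ (m , ℕ.s≤s ℕ.z≤n , p , (begin
    - thetas M                                         ≡⟨ cong -_ (trans (sym (jacobi≡thetas M)) (trans (cong jacobi p) (jacobi-square m-1))) ⟩
    - (+ 2 * (χ (cl (+ m)) * + m))                     ≡⟨ cong (λ z → - (+ 2 * (z * + m))) (χ-power m (odd-square (cl (+ m)) residue)) ⟩
    - (+ 2 * (- (-[1+ 0 ] ℤ.^ (ℕ.suc m ℕ./ 2)) * + m)) ≡⟨ signs (-[1+ 0 ] ℤ.^ (ℕ.suc m ℕ./ 2)) (+ m) ⟩
    + 2 * (-[1+ 0 ] ℤ.^ (ℕ.suc m ℕ./ 2)) * + m         ∎))
  where
  open ≡-Reasoning
  M = 4 ℕ.* n ℕ.+ 5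
  signs : ∀ s m → - (+ 2 * (- s * m)) ≡ + 2 * s * m
  signs = solve-∀
  -- M ≡ 1 modulo 4 makes m odd, as `χ-power` requires.
  residue : square₄ (cl (+ m)) ≡ 1F
  residue = trans (sym (cl-* (+ m) (+ m))) (trans (cong cl (trans (sym (ℤP.pos-* m m)) (cong +_ (sym p)))) (cl-4n+5 n))

-- One integer v serves both differences; multiplying by 2 and by 3 keeps the equations in ℤ.
theorem2p1 : (n : ℕ) → 0 < n →
    ∃ λ v → RHS n v
    × (+ 2 * + t (1 ∷ 1 ∷ 8 ∷ []) n - + N (1 ∷ 1 ∷ 8 ∷ []) (8 ℕ.* n ℕ.+ 10) ≡ + 2 * v)
    × (+ 3 * + t (1 ∷ 1 ∷ 8 ∷ []) n - + r₃ (4 ℕ.* n ℕ.+ 5) ≡ + 3 * v)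
theorem2p1 n _ = - thetas (4 ℕ.* n ℕ.+ 5) , rhs n , 2t-N n , 3t-r₃ n
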